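{- For every $n\ge1$ and every permutation $w\in S_n$ avoiding the patterns $1432$ and $1423$, one has $c_w\ge 0$, where the integers $c_w$ ($w\in S_m$, $m\ge1$) are defined recursively by \[ c_w := \mathfrak{S}_w(\mathbf 1) - 1 - \sum_{u:\ |u|<|w|} c_u\, p_u(w), \] the sum ranging over permutations $u\in S_m$ with $1\le m<|w|$.
   Context: For $w\in S_m$ write $|w|=m$. $\mathfrak{S}_w(\mathbf 1)$ is the Schubert polynomial $\mathfrak{S}_w$ evaluated with all variables equal to $1$. $p_u(w)$ is the number of occurrences of $u$ as a pattern in $w$, i.e. the number of index sets $i_1<\dots<i_{|u|}$ such that $w(i_1)\cdots w(i_{|u|})$ has the same relative order as $u$. $w$ avoids a pattern $\pi$ if $p_\pi(w)=0$. -}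

module Defs where

open import Data.Nat as ℕ using (ℕ; zero; suc; _∸_; _<ᵇ_)
open import Data.Integer as ℤ using (ℤ; +_; -_)
open import Data.List using (List; []; _∷_; map; length; _++_; concatMap; upTo; filter; foldr)
open import Data.List.Properties using (≡-dec)
open import Data.Product using (_×_; _,_)
open import Data.Bool using (Bool; true; false; if_then_else_)
open import Relation.Binary.PropositionalEquality using (_≡_)
open import Relation.Nullary using (Dec; yes; no)

-- Permutations in one-line notation: a permutation of S_n is a list of
-- naturals that is a rearrangement of [1, ..., n].

oneTo : ℕ → List ℕ
oneTo n = map suc (upTo n)

insertions : {A : Set} → A → List A → List (List A)
insertions x [] = (x ∷ []) ∷ []
insertions x (y ∷ ys) = (x ∷ y ∷ ys) ∷ map (y ∷_) (insertions x ys)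

perms : {A : Set} → List A → List (List A)
perms [] = [] ∷ []
perms (x ∷ xs) = concatMap (insertions x) (perms xs)

Sym : ℕ → List (List ℕ)
Sym m = perms (oneTo m)

choose : {A : Set} → ℕ → List A → List (List A)
choose zero _ = [] ∷ []
choose (suc k) [] = []
choose (suc k) (x ∷ xs) = map (x ∷_) (choose k xs) ++ choose (suc k) xs

countLess : ℕ → List ℕ → ℕ
countLess x [] = 0
countLess x (y ∷ ys) = (if y <ᵇ x then 1 else 0) ℕ.+ countLess x ys

std : List ℕ → List ℕ
std s = map (λ x → suc (countLess x s)) s

_≟L_ : (u v : List ℕ) → Dec (u ≡ v)
_≟L_ = ≡-dec ℕ._≟_

occ : List ℕ → List ℕ → ℕ
occ u w = length (filter (λ s → std s ≟L u) (choose (length u) w))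

Avoids : List ℕ → List ℕ → Set
Avoids π w = occ π w ≡ 0

-- Schubert polynomials via divided differences.
-- A polynomial in variables x_1..x_n is a (not necessarily normalised)
-- list of terms (coefficient , exponent vector as a list).

Poly : Set
Poly = List (ℤ × List ℕ)

get : List ℕ → ℕ → ℕ
get [] _ = 0
get (x ∷ xs) zero = x
get (x ∷ xs) (suc i) = get xs i

setAt : List ℕ → ℕ → ℕ → List ℕ
setAt [] _ _ = []
setAt (x ∷ xs) zero v = v ∷ xs
setAt (x ∷ xs) (suc i) v = x ∷ setAt xs i v

-- divided difference ∂_i (0-based i: acts on x_{i+1}, x_{i+2}) on a term:
--   ∂(x^a y^b) = Σ_{k<a-b} x^{a-1-k} y^{b+k}       if a > b
--              = 0                                 if a = b
--              = - Σ_{k<b-a} x^{b-1-k} y^{a+k}     if a < b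
ddTerm : ℕ → ℤ × List ℕ → Poly
ddTerm i (c , e) with get e i | get e (suc i)
... | a | b =
  if b <ᵇ a
  then map (λ k → c , setAt (setAt e i (a ∸ 1 ∸ k)) (suc i) (b ℕ.+ k)) (upTo (a ∸ b))
  else map (λ k → ℤ.- c , setAt (setAt e i (b ∸ 1 ∸ k)) (suc i) (a ℕ.+ k)) (upTo (b ∸ a))

dd : ℕ → Poly → Poly
dd i = concatMap (ddTerm i)

staircase : ℕ → Poly
staircase n = (+ 1 , map (λ k → n ∸ 1 ∸ k) (upTo n)) ∷ []

data Maybeℕ : Set where
  none : Maybeℕ
  some : ℕ → Maybeℕ

shiftM : Maybeℕ → Maybeℕ
shiftM none = none
shiftM (some i) = some (suc i)

ascFrom : ℕ → List ℕ → Maybeℕ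
ascFrom x [] = none
ascFrom x (y ∷ ys) = if x <ᵇ y then some 0 else shiftM (ascFrom y ys)

firstAscent : List ℕ → Maybeℕ
firstAscent [] = none
firstAscent (x ∷ ys) = ascFrom x ys

swapAt : ℕ → List ℕ → List ℕ
swapAt zero (x ∷ y ∷ ys) = y ∷ x ∷ ys
swapAt (suc i) (x ∷ xs) = x ∷ swapAt i xs
swapAt _ xs = xs

-- 𝔖_{w0} = x^δ, and 𝔖_w = ∂_i 𝔖_{w s_i} whenever w(i) < w(i+1).
-- (Fuel-bounded recursion: each step raises the length by one, so
-- fuel n*n is more than enough; with no ascent, w = w0.)
schubAux : ℕ → ℕ → List ℕ → Poly
schubAux n zero w = staircase n
schubAux n (suc f) w with firstAscent w
... | none = staircase n
... | some i = dd i (schubAux n f (swapAt i w))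

schubert : List ℕ → Poly
schubert w = schubAux (length w) (length w ℕ.* length w) w

sumℤ : List ℤ → ℤ
sumℤ = foldr ℤ._+_ (+ 0)

evalOne : Poly → ℤ
evalOne p = sumℤ (map (λ t → Data.Product.proj₁ t) p)
  where import Data.Product

schubOne : List ℕ → ℤ
schubOne w = evalOne (schubert w)

-- c_w = 𝔖_w(1) - 1 - Σ_{1 ≤ m < |w|} Σ_{u ∈ S_m} c_u p_u(w)
-- (fuel f ≥ |w| guarantees full recursion depth)

cAux : ℕ → List ℕ → ℤ
cAux zero w = + 0
cAux (suc f) w =
  schubOne w ℤ.- + 1 ℤ.-
  sumℤ (map (λ m → sumℤ (map (λ u → cAux f u ℤ.* + occ u w) (Sym m)))
            (map suc (upTo (length w ∸ 1))))

c : List ℕ → ℤ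
c w = cAux (length w) w

IsPerm : ℕ → List ℕ → Set
IsPerm n w = w ∈Sym n
  where
  open import Data.List.Membership.Propositional using (_∈_)
  _∈Sym_ : List ℕ → ℕ → Set
  v ∈Sym m = v ∈ Sym m

{-# OPTIONS --safe #-}

-- For a position p of w let D_p be the set of positions i < p with w(i) > w(p) (a column of the
-- Rothe diagram).  If w avoids 1432 and 1423, then 𝔖_w is the product over p of Σ_{C ≤ D_p} x^C, with
-- ≤ the Gale order.  This is proved along first ascents: swapping the first ascent a b preserves the
-- avoidance, and by avoidance at most one later value lies between a and b, so the product for the
-- swapped permutation is x_i times a polynomial which is symmetric in x_i, x_{i+1} up to one column.
--
-- Hence 𝔖_w(1) counts the families (C_p ≤ D_p)_p.  Let the support of a family consist of all
-- C_p △ D_p and all p with C_p ≠ D_p.  Families with support in I are the same as families of the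
-- pattern w|_I, so 𝔖_w(1) = Σ_I d(w|_I), where d counts the families with full support.  By the
-- recursion c_w = d(w), which is non-negative.
module Submission where

open import Defs
open import Data.Nat using (ℕ; _≤_)
open import Data.Integer using (+_) renaming (_≤_ to _≤ℤ_)
open import Data.List using (List; _∷_; [])

open import Data.Bool using (Bool; true; false; if_then_else_; _∨_; T)
open import Data.Bool.ListAction using (or; and)
open import Data.Empty using (⊥; ⊥-elim)
open import Data.Integer using (ℤ; +≤+) renaming (_+_ to _+ℤ_; _*_ to _*ℤ_; _-_ to _-ℤ_; -_ to neg)
import Data.Integer.Properties as ℤₚ
import Data.Integer.Solver as ℤSolver
open import Data.List using (_++_; map; length; concatMap; replicate; upTo; applyUpTo; [_]; filter)
import Data.List.Properties as Listₚ
open import Data.List.Membership.Propositional using (_∈_; find)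
import Data.List.Membership.Propositional.Properties as ∈ₚ
open import Data.List.Relation.Binary.Permutation.Propositional as Perm using (_↭_; ↭-sym; ↭-trans; ↭-reflexive; ↭⇒↭ₛ)
import Data.List.Relation.Binary.Permutation.Propositional.Properties as Permₚ
import Data.List.Relation.Binary.Permutation.Setoid.Properties as PermSₚ
open import Data.List.Relation.Binary.Sublist.Propositional as Sub using (_⊆_; []; _∷_; _∷ʳ_; ⊆-trans)
import Data.List.Relation.Binary.Sublist.Propositional.Properties as Subₚ
open import Data.List.Relation.Unary.All as All using (All; []; _∷_)
import Data.List.Relation.Unary.All.Properties as Allₚ
open import Data.List.Relation.Unary.AllPairs as AllPairs using (AllPairs; []; _∷_)
open import Data.List.Relation.Unary.Any using (here; there)
open import Data.List.Relation.Unary.Sorted.TotalOrder.Properties using (Sorted⇒AllPairs)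
open import Data.List.Relation.Unary.Unique.Propositional using (Unique)
import Data.List.Relation.Unary.Unique.Propositional.Properties as Uniqueₚ
open import Data.Nat as ℕ using (zero; suc; _<_; _>_; z≤n; s≤s; _∸_; _<ᵇ_)
import Data.Nat.Properties as ℕₚ
import Data.Nat.Solver as ℕSolver
open import Data.List.Sort ℕₚ.≤-decTotalOrder using (sort; sort-↭; sort-↗)
open import Data.Product using (_×_; _,_; proj₁; proj₂; ∃)
open import Data.Sum using (_⊎_; inj₁; inj₂)
open import Data.Unit using (tt)
open import Function using (_∘_; const; id)
open import Relation.Binary.Definitions using (tri<; tri≈; tri>)
open import Relation.Binary.PropositionalEquality hiding ([_])
open import Relation.Nullary using (Dec; yes; no; ¬_)

-- Let `a b` be the first ascent of w, at positions i and i+1, and let w′ be w with the two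
-- exchanged. Everything before `a` exceeds it, so the column of `a` is the whole interval to its
-- left, and in w′ this interval contains one position more: that is the factor x_i. The columns at
-- positions up to i+1 otherwise involve only variables before x_i and are constants for ∂_i. A
-- later value that is not between a and b has the letters 00 or 11 at i, i+1, in w and in w′ alike;
-- a value strictly between has 10 in w′ and 01 in w. A column polynomial with letters 00, 11 or 01
-- is symmetric in x_i, x_{i+1}, and 10 is the only obstacle. One such column can be corrected by a
-- multiple of x_{i+1}, which ∂_i kills together with the factor x_i; two of them would also produce
-- x_{i+1}^2. The patterns 1432 and 1423 are exactly the two ways in which two values between a and
-- b can follow an ascent.

private variable
  A B : Set
  P Q : Set

-- Finite sums

∑ : List A → (A → ℤ) → ℤ
∑ xs f = sumℤ (map f xs)

∑-cong-∈ : (xs : List A) {f g : A → ℤ} → (∀ {x} → x ∈ xs → f x ≡ g x) → ∑ xs f ≡ ∑ xs g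
∑-cong-∈ []       eq = refl
∑-cong-∈ (x ∷ xs) eq = cong₂ _+ℤ_ (eq (here refl)) (∑-cong-∈ xs (eq ∘ there))

∑-cong : (xs : List A) {f g : A → ℤ} → (∀ x → f x ≡ g x) → ∑ xs f ≡ ∑ xs g
∑-cong xs eq = ∑-cong-∈ xs (λ {x} _ → eq x)

∑-++ : (xs ys : List A) (f : A → ℤ) → ∑ (xs ++ ys) f ≡ ∑ xs f +ℤ ∑ ys f
∑-++ []       ys f = sym (ℤₚ.+-identityˡ _)
∑-++ (x ∷ xs) ys f = trans (cong (f x +ℤ_) (∑-++ xs ys f)) (sym (ℤₚ.+-assoc (f x) _ _))

∑-map : (g : A → B) (xs : List A) (f : B → ℤ) → ∑ (map g xs) f ≡ ∑ xs (f ∘ g)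
∑-map g []       f = refl
∑-map g (x ∷ xs) f = cong (f (g x) +ℤ_) (∑-map g xs f)

∑-concatMap : (g : A → List B) (xs : List A) (f : B → ℤ) →
              ∑ (concatMap g xs) f ≡ ∑ xs (λ x → ∑ (g x) f)
∑-concatMap g []       f = refl
∑-concatMap g (x ∷ xs) f =
  trans (∑-++ (g x) (concatMap g xs) f) (cong (∑ (g x) f +ℤ_) (∑-concatMap g xs f))

∑-zero : (xs : List A) → ∑ xs (const (+ 0)) ≡ + 0
∑-zero []       = refl
∑-zero (x ∷ xs) = trans (ℤₚ.+-identityˡ _) (∑-zero xs)

+-interchange : ∀ a b c d → (a +ℤ b) +ℤ (c +ℤ d) ≡ (a +ℤ c) +ℤ (b +ℤ d)
+-interchange a b c d = begin
  (a +ℤ b) +ℤ (c +ℤ d)   ≡⟨ ℤₚ.+-assoc a b _ ⟩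
  a +ℤ (b +ℤ (c +ℤ d))   ≡⟨ cong (a +ℤ_) (sym (ℤₚ.+-assoc b c d)) ⟩
  a +ℤ ((b +ℤ c) +ℤ d)   ≡⟨ cong (λ z → a +ℤ (z +ℤ d)) (ℤₚ.+-comm b c) ⟩
  a +ℤ ((c +ℤ b) +ℤ d)   ≡⟨ cong (a +ℤ_) (ℤₚ.+-assoc c b d) ⟩
  a +ℤ (c +ℤ (b +ℤ d))   ≡⟨ sym (ℤₚ.+-assoc a c _) ⟩
  (a +ℤ c) +ℤ (b +ℤ d)   ∎
  where open ≡-Reasoning

∑-distrib-+ : (xs : List A) (f g : A → ℤ) → ∑ xs (λ x → f x +ℤ g x) ≡ ∑ xs f +ℤ ∑ xs g
∑-distrib-+ []       f g = refl
∑-distrib-+ (x ∷ xs) f g =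
  trans (cong (f x +ℤ g x +ℤ_) (∑-distrib-+ xs f g)) (+-interchange (f x) (g x) _ _)

∑-*ˡ : (xs : List A) (c : ℤ) (f : A → ℤ) → ∑ xs (λ x → c *ℤ f x) ≡ c *ℤ ∑ xs f
∑-*ˡ []       c f = sym (ℤₚ.*-zeroʳ c)
∑-*ˡ (x ∷ xs) c f =
  trans (cong (c *ℤ f x +ℤ_) (∑-*ˡ xs c f)) (sym (ℤₚ.*-distribˡ-+ c (f x) _))

∑-neg : (xs : List A) (f : A → ℤ) → ∑ xs (λ x → neg (f x)) ≡ neg (∑ xs f)
∑-neg []       f = refl
∑-neg (x ∷ xs) f = trans (cong (neg (f x) +ℤ_) (∑-neg xs f)) (sym (ℤₚ.neg-distrib-+ (f x) _))

∑-distrib-- : (xs : List A) (f g : A → ℤ) → ∑ xs (λ x → f x -ℤ g x) ≡ ∑ xs f -ℤ ∑ xs g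
∑-distrib-- xs f g = trans (∑-distrib-+ xs f (λ x → neg (g x))) (cong (∑ xs f +ℤ_) (∑-neg xs g))

∑-swap : (xs : List A) (ys : List B) (f : A → B → ℤ) →
         ∑ xs (λ x → ∑ ys (f x)) ≡ ∑ ys (λ y → ∑ xs (λ x → f x y))
∑-swap []       ys f = sym (∑-zero ys)
∑-swap (x ∷ xs) ys f =
  trans (cong (∑ ys (f x) +ℤ_) (∑-swap xs ys f)) (sym (∑-distrib-+ ys (f x) _))

∑-nonneg : (xs : List A) {f : A → ℤ} → (∀ x → + 0 ≤ℤ f x) → + 0 ≤ℤ ∑ xs f
∑-nonneg []       0≤f = ℤₚ.≤-refl
∑-nonneg (x ∷ xs) 0≤f = ℤₚ.+-mono-≤ (0≤f x) (∑-nonneg xs 0≤f)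

-- Gale-lower words

-- The second word fixes the length: a column at p has letters only for the positions before p,
-- while the accumulated word covers all positions.
overlay : (A → A → A) → List A → List A → List A
overlay _∙_ []      v       = v
overlay _∙_ (x ∷ u) []      = []
overlay _∙_ (x ∷ u) (y ∷ v) = (x ∙ y) ∷ overlay _∙_ u v

length-overlay : ∀ (_∙_ : A → A → A) u v → length (overlay _∙_ u v) ≡ length v
length-overlay _∙_ []      v       = refl
length-overlay _∙_ (x ∷ u) []      = refl
length-overlay _∙_ (x ∷ u) (y ∷ v) = cong suc (length-overlay _∙_ u v)

-- The words C ≤ b in the Gale order: C and b have equally many ones, and every prefix of C has at
-- least as many ones as that of b.  The counter k is the current surplus of C; the letter of C
-- over the letter d of b is recorded as keep d if it is d and as flip d otherwise.
module _ (keep flip : Bool → A) where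

  lower : ℕ → List Bool → List (List A)
  lower zero    []          = [ [] ]
  lower (suc k) []          = []
  lower k       (false ∷ b) = map (keep false ∷_) (lower k b) ++ map (flip false ∷_) (lower (suc k) b)
  lower zero    (true ∷ b)  = map (keep true ∷_) (lower zero b)
  lower (suc k) (true ∷ b)  = map (keep true ∷_) (lower (suc k) b) ++ map (flip true ∷_) (lower k b)

  ∑-lower-false : ∀ k b φ → ∑ (lower k (false ∷ b)) φ ≡
    ∑ (lower k b) (φ ∘ (keep false ∷_)) +ℤ ∑ (lower (suc k) b) (φ ∘ (flip false ∷_))
  ∑-lower-false zero b φ =
    trans (∑-++ (map (keep false ∷_) (lower zero b)) _ φ)
      (cong₂ _+ℤ_ (∑-map _ (lower zero b) φ) (∑-map _ (lower 1 b) φ))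
  ∑-lower-false (suc k) b φ =
    trans (∑-++ (map (keep false ∷_) (lower (suc k) b)) _ φ)
      (cong₂ _+ℤ_ (∑-map _ (lower (suc k) b) φ) (∑-map _ (lower (suc (suc k)) b) φ))

  ∑-lower-true₀ : ∀ b φ → ∑ (lower zero (true ∷ b)) φ ≡ ∑ (lower zero b) (φ ∘ (keep true ∷_))
  ∑-lower-true₀ b φ = ∑-map _ (lower zero b) φ

  ∑-lower-true₊ : ∀ k b φ → ∑ (lower (suc k) (true ∷ b)) φ ≡
    ∑ (lower (suc k) b) (φ ∘ (keep true ∷_)) +ℤ ∑ (lower k b) (φ ∘ (flip true ∷_))
  ∑-lower-true₊ k b φ =
    trans (∑-++ (map (keep true ∷_) (lower (suc k) b)) _ φ)
      (cong₂ _+ℤ_ (∑-map _ (lower (suc k) b) φ) (∑-map _ (lower k b) φ))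

  ∑-lower-cong : ∀ k b {φ ψ : List A → ℤ} → (∀ u → length u ≡ length b → φ u ≡ ψ u) →
                 ∑ (lower k b) φ ≡ ∑ (lower k b) ψ
  ∑-lower-cong zero    []          eq = cong (_+ℤ + 0) (eq [] refl)
  ∑-lower-cong (suc k) []          eq = refl
  ∑-lower-cong k       (false ∷ b) {φ} {ψ} eq =
    trans (∑-lower-false k b φ)
      (trans (cong₂ _+ℤ_ (∑-lower-cong k b (λ u p → eq _ (cong suc p)))
                          (∑-lower-cong (suc k) b (λ u p → eq _ (cong suc p))))
             (sym (∑-lower-false k b ψ)))
  ∑-lower-cong zero    (true ∷ b)  {φ} {ψ} eq =
    trans (∑-lower-true₀ b φ)
      (trans (∑-lower-cong zero b (λ u p → eq _ (cong suc p))) (sym (∑-lower-true₀ b ψ)))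
  ∑-lower-cong (suc k) (true ∷ b)  {φ} {ψ} eq =
    trans (∑-lower-true₊ k b φ)
      (trans (cong₂ _+ℤ_ (∑-lower-cong (suc k) b (λ u p → eq _ (cong suc p)))
                          (∑-lower-cong k b (λ u p → eq _ (cong suc p))))
             (sym (∑-lower-true₊ k b ψ)))

  ∑-lower-ones : ∀ m φ → ∑ (lower zero (replicate m true)) φ ≡ φ (replicate m (keep true))
  ∑-lower-ones zero    φ = ℤₚ.+-identityʳ _
  ∑-lower-ones (suc m) φ = trans (∑-lower-true₀ (replicate m true) φ) (∑-lower-ones m _)

-- The branching of `lower` does not depend on the recorded letters. With all variables at 1 the
-- exponent words of a column may therefore be traded for its difference words.
∑-lower-const : {keep flip : Bool → A} {keep′ flip′ : Bool → B} → ∀ k b (v : ℤ) →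
                ∑ (lower keep flip k b) (const v) ≡ ∑ (lower keep′ flip′ k b) (const v)
∑-lower-const zero    []          v = refl
∑-lower-const (suc k) []          v = refl
∑-lower-const k       (false ∷ b) v =
  trans (∑-lower-false _ _ k b _)
    (trans (cong₂ _+ℤ_ (∑-lower-const k b v) (∑-lower-const (suc k) b v)) (sym (∑-lower-false _ _ k b _)))
∑-lower-const zero    (true ∷ b)  v =
  trans (∑-lower-true₀ _ _ b _) (trans (∑-lower-const zero b v) (sym (∑-lower-true₀ _ _ b _)))
∑-lower-const (suc k) (true ∷ b)  v =
  trans (∑-lower-true₊ _ _ k b _)
    (trans (cong₂ _+ℤ_ (∑-lower-const (suc k) b v) (∑-lower-const k b v)) (sym (∑-lower-true₊ _ _ k b _)))

-- bits s y is the indicator word of the Rothe column of the value y preceded by the values s.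
bits : List ℕ → ℕ → List Bool
bits s y = map (y <ᵇ_) s

-- Supports of families

diffs : ℕ → List Bool → List (List Bool)
diffs = lower (const false) (const true)

-- The appended letter is that of the position carrying the column. It ensures that deleting this
-- position forces C_p = D_p.
close : List Bool → List Bool
close u = u ++ [ or u ]

-- One word per family (C_p ≤ D_p)_p, p ranging over the positions of w in s ++ w: the indicator of
-- the union of the sets C_p △ D_p and of the positions p with C_p ≠ D_p.
supports : List ℕ → List ℕ → List (List Bool)
supports s []      = [ replicate (length s) false ]
supports s (y ∷ w) =
  concatMap (λ u → map (overlay _∨_ (close u)) (supports (s ++ [ y ]) w)) (diffs 0 (bits s y))

∑-supports-∷ : ∀ s y w φ → ∑ (supports s (y ∷ w)) φ ≡
  ∑ (diffs 0 (bits s y)) (λ u → ∑ (supports (s ++ [ y ]) w) (φ ∘ overlay _∨_ (close u)))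
∑-supports-∷ s y w φ =
  trans (∑-concatMap _ (diffs 0 (bits s y)) φ)
        (∑-cong (diffs 0 (bits s y)) (λ u → ∑-map _ (supports (s ++ [ y ]) w) φ))

length-snoc-+ : (s : List A) (y : A) (n : ℕ) → length (s ++ [ y ]) ℕ.+ n ≡ length s ℕ.+ suc n
length-snoc-+ s y n =
  trans (cong (ℕ._+ n) (Listₚ.length-++ s)) (ℕₚ.+-assoc (length s) 1 n)

∑-supports-cong : ∀ s w {φ ψ : List Bool → ℤ} →
  (∀ u → length u ≡ length s ℕ.+ length w → φ u ≡ ψ u) → ∑ (supports s w) φ ≡ ∑ (supports s w) ψ
∑-supports-cong s [] eq =
  cong (_+ℤ + 0) (eq _ (trans (Listₚ.length-replicate (length s)) (sym (ℕₚ.+-identityʳ _))))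
∑-supports-cong s (y ∷ w) {φ} {ψ} eq =
  trans (∑-supports-∷ s y w φ)
    (trans (∑-cong (diffs 0 (bits s y)) (λ u → ∑-supports-cong (s ++ [ y ]) w (λ v len →
              eq _ (trans (length-overlay _∨_ (close u) v) (trans len (length-snoc-+ s y (length w)))))))
           (sym (∑-supports-∷ s y w ψ)))

-- Restriction to a set of positions

select : List Bool → List A → List A
select (true  ∷ I) (x ∷ xs) = x ∷ select I xs
select (false ∷ I) (x ∷ xs) = select I xs
select _           _        = []

select-map : ∀ (f : A → B) I xs → select I (map f xs) ≡ map f (select I xs)
select-map f []          []       = refl
select-map f []          (x ∷ xs) = refl
select-map f (true ∷ I)  []       = refl
select-map f (false ∷ I) []       = refl
select-map f (true ∷ I)  (x ∷ xs) = cong (f x ∷_) (select-map f I xs)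
select-map f (false ∷ I) (x ∷ xs) = select-map f I xs

select-snoc : ∀ J (s : List A) j y → length J ≡ length s →
              select (J ++ [ j ]) (s ++ [ y ]) ≡ select J s ++ select [ j ] [ y ]
select-snoc []          []      true  y eq = refl
select-snoc []          []      false y eq = refl
select-snoc (true ∷ J)  (x ∷ s) j     y eq = cong (x ∷_) (select-snoc J s j y (ℕₚ.suc-injective eq))
select-snoc (false ∷ J) (x ∷ s) j     y eq = select-snoc J s j y (ℕₚ.suc-injective eq)

-- restrict I ψ u is ψ (select I u) if u ⊆ I, and 0 otherwise.
restrict : List Bool → (List Bool → ℤ) → List Bool → ℤ
restrict []          ψ u           = ψ u
restrict (i ∷ I)     ψ []          = + 0
restrict (true ∷ I)  ψ (c ∷ u)     = restrict I (ψ ∘ (c ∷_)) u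
restrict (false ∷ I) ψ (true ∷ u)  = + 0
restrict (false ∷ I) ψ (false ∷ u) = restrict I ψ u

restrict-cong : ∀ I {φ ψ} u → (∀ v → φ v ≡ ψ v) → restrict I φ u ≡ restrict I ψ u
restrict-cong []          u           eq = eq u
restrict-cong (i ∷ I)     []          eq = refl
restrict-cong (true ∷ I)  (c ∷ u)     eq = restrict-cong I u (λ v → eq (c ∷ v))
restrict-cong (false ∷ I) (true ∷ u)  eq = refl
restrict-cong (false ∷ I) (false ∷ u) eq = restrict-cong I u eq

restrict-∑ : ∀ I (xs : List A) (F : A → List Bool → ℤ) u →
             restrict I (λ v → ∑ xs (λ x → F x v)) u ≡ ∑ xs (λ x → restrict I (F x) u)
restrict-∑ []          xs F u           = refl
restrict-∑ (i ∷ I)     xs F []          = sym (∑-zero xs)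
restrict-∑ (true ∷ I)  xs F (c ∷ u)     = restrict-∑ I xs (λ x v → F x (c ∷ v)) u
restrict-∑ (false ∷ I) xs F (true ∷ u)  = sym (∑-zero xs)
restrict-∑ (false ∷ I) xs F (false ∷ u) = restrict-∑ I xs F u

-- The zero function is an empty sum; the element type of the empty list is arbitrary.
restrict-zero : ∀ I u → restrict I (const (+ 0)) u ≡ + 0
restrict-zero I u = restrict-∑ I ([] {A = ℕ}) (λ _ _ → + 0) u

-- A union lies in a set exactly when both parts do, and selection commutes with unions. This
-- separates the current column from the later ones; it has no letters in the region of `K`.
restrict-overlay : ∀ I K ψ u v → length u ≡ length I →
  restrict (I ++ K) ψ (overlay _∨_ u v) ≡
  restrict I (λ u′ → restrict (I ++ K) (λ v′ → ψ (overlay _∨_ u′ v′)) v) u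
restrict-overlay []          K ψ []          v           len = refl
restrict-overlay (i ∷ I)     K ψ (c ∷ u)     []          len = sym (restrict-zero (i ∷ I) (c ∷ u))
restrict-overlay (true ∷ I)  K ψ (c ∷ u)     (d ∷ v)     len =
  restrict-overlay I K (ψ ∘ ((c ∨ d) ∷_)) u v (ℕₚ.suc-injective len)
restrict-overlay (false ∷ I) K ψ (true ∷ u)  (d ∷ v)     len = refl
restrict-overlay (false ∷ I) K ψ (false ∷ u) (true ∷ v)  len = sym (restrict-zero I u)
restrict-overlay (false ∷ I) K ψ (false ∷ u) (false ∷ v) len =
  restrict-overlay I K ψ u v (ℕₚ.suc-injective len)

-- The last letter depends on the whole word, so `g` carries the disjunction of the letters already
-- read. Deleted letters are `false` and do not affect it.
restrict-snoc-true : ∀ J ψ u (g : Bool → Bool) → length u ≡ length J →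
  restrict (J ++ [ true ]) ψ (u ++ [ g (or u) ]) ≡ restrict J (λ v → ψ (v ++ [ g (or v) ])) u
restrict-snoc-true []          ψ []          g len = refl
restrict-snoc-true (true ∷ J)  ψ (c ∷ u)     g len =
  restrict-snoc-true J (ψ ∘ (c ∷_)) u (g ∘ (c ∨_)) (ℕₚ.suc-injective len)
restrict-snoc-true (false ∷ J) ψ (true ∷ u)  g len = refl
restrict-snoc-true (false ∷ J) ψ (false ∷ u) g len = restrict-snoc-true J ψ u g (ℕₚ.suc-injective len)

restrict-snoc-false : ∀ J ψ u o → length u ≡ length J →
  restrict (J ++ [ false ]) ψ (u ++ [ o ]) ≡ (if o then + 0 else restrict J ψ u)
restrict-snoc-false []          ψ []          true  len = refl
restrict-snoc-false []          ψ []          false len = refl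
restrict-snoc-false (true ∷ J)  ψ (c ∷ u)     o     len =
  restrict-snoc-false J (ψ ∘ (c ∷_)) u o (ℕₚ.suc-injective len)
restrict-snoc-false (false ∷ J) ψ (true ∷ u)  true  len = refl
restrict-snoc-false (false ∷ J) ψ (true ∷ u)  false len = refl
restrict-snoc-false (false ∷ J) ψ (false ∷ u) o     len =
  restrict-snoc-false J ψ u o (ℕₚ.suc-injective len)

restrict-falses : ∀ J ψ (xs : List A) → length J ≡ length xs →
  restrict J ψ (replicate (length xs) false) ≡ ψ (replicate (length (select J xs)) false)
restrict-falses []          ψ []       len = refl
restrict-falses (true ∷ J)  ψ (x ∷ xs) len = restrict-falses J (ψ ∘ (false ∷_)) xs (ℕₚ.suc-injective len)
restrict-falses (false ∷ J) ψ (x ∷ xs) len = restrict-falses J ψ xs (ℕₚ.suc-injective len)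

overlay-falses : ∀ m v → overlay _∨_ (replicate m false) v ≡ v
overlay-falses zero    v       = refl
overlay-falses (suc m) []      = refl
overlay-falses (suc m) (c ∷ v) = cong (c ∷_) (overlay-falses m v)

private
  ∑-lower-falseᵈ = ∑-lower-false (const false) (const true)
  ∑-lower-true₀ᵈ = ∑-lower-true₀ (const false) (const true)
  ∑-lower-true₊ᵈ = ∑-lower-true₊ (const false) (const true)

-- At a deleted position C and D agree, so the surplus is unchanged there and the Gale condition is
-- just the condition on the selected letters.
∑-diffs-restrict : ∀ k J b ψ → length J ≡ length b →
                   ∑ (diffs k b) (restrict J ψ) ≡ ∑ (diffs k (select J b)) ψ
∑-diffs-restrict zero    []          []          ψ len = refl
∑-diffs-restrict (suc k) []          []          ψ len = refl
∑-diffs-restrict k       (true ∷ J)  (false ∷ b) ψ len =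
  trans (∑-lower-falseᵈ k b _)
    (trans (cong₂ _+ℤ_ (∑-diffs-restrict k J b _ (ℕₚ.suc-injective len))
                       (∑-diffs-restrict (suc k) J b _ (ℕₚ.suc-injective len)))
           (sym (∑-lower-falseᵈ k (select J b) ψ)))
∑-diffs-restrict zero    (true ∷ J)  (true ∷ b)  ψ len =
  trans (∑-lower-true₀ᵈ b _)
    (trans (∑-diffs-restrict zero J b _ (ℕₚ.suc-injective len))
           (sym (∑-lower-true₀ᵈ (select J b) ψ)))
∑-diffs-restrict (suc k) (true ∷ J)  (true ∷ b)  ψ len =
  trans (∑-lower-true₊ᵈ k b _)
    (trans (cong₂ _+ℤ_ (∑-diffs-restrict (suc k) J b _ (ℕₚ.suc-injective len))
                       (∑-diffs-restrict k J b _ (ℕₚ.suc-injective len)))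
           (sym (∑-lower-true₊ᵈ k (select J b) ψ)))
∑-diffs-restrict k       (false ∷ J) (false ∷ b) ψ len =
  trans (∑-lower-falseᵈ k b _)
    (trans (cong₂ _+ℤ_ (∑-diffs-restrict k J b ψ (ℕₚ.suc-injective len)) (∑-zero (diffs (suc k) b)))
           (ℤₚ.+-identityʳ _))
∑-diffs-restrict zero    (false ∷ J) (true ∷ b)  ψ len =
  trans (∑-lower-true₀ᵈ b _) (∑-diffs-restrict zero J b ψ (ℕₚ.suc-injective len))
∑-diffs-restrict (suc k) (false ∷ J) (true ∷ b)  ψ len =
  trans (∑-lower-true₊ᵈ k b _)
    (trans (cong₂ _+ℤ_ (∑-diffs-restrict (suc k) J b ψ (ℕₚ.suc-injective len)) (∑-zero (diffs k b)))
           (ℤₚ.+-identityʳ _))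

unless-or : (List Bool → ℤ) → List Bool → ℤ
unless-or g u = if or u then + 0 else g u

-- A positive surplus can return to zero only at a position where C and D differ, and such words are
-- excluded by `unless-or`.
∑-diffs-unless-or₊ : ∀ k b g → ∑ (diffs (suc k) b) (unless-or g) ≡ + 0
∑-diffs-unless-or₊ k []          g = refl
∑-diffs-unless-or₊ k (false ∷ b) g =
  trans (∑-lower-falseᵈ (suc k) b (unless-or g))
    (cong₂ _+ℤ_ (∑-diffs-unless-or₊ k b _) (∑-zero (diffs (suc (suc k)) b)))
∑-diffs-unless-or₊ k (true ∷ b)  g =
  trans (∑-lower-true₊ᵈ k b (unless-or g))
    (cong₂ _+ℤ_ (∑-diffs-unless-or₊ k b _) (∑-zero (diffs k b)))

∑-diffs-unless-or : ∀ b g → ∑ (diffs 0 b) (unless-or g) ≡ g (replicate (length b) false)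
∑-diffs-unless-or []          g = ℤₚ.+-identityʳ _
∑-diffs-unless-or (false ∷ b) g =
  trans (∑-lower-falseᵈ 0 b (unless-or g))
    (trans (cong₂ _+ℤ_ (∑-diffs-unless-or b _) (∑-zero (diffs 1 b))) (ℤₚ.+-identityʳ _))
∑-diffs-unless-or (true ∷ b)  g = trans (∑-lower-true₀ᵈ b (unless-or g)) (∑-diffs-unless-or b _)

-- Induction over the columns. At a kept position the column turns into that of the pattern; at a
-- deleted one the closing letter leaves only C_p = D_p, so the column contributes a single choice
-- and vanishes, as it does from the pattern.
∑-supports-restrict : ∀ J s K w ψ → length J ≡ length s → length K ≡ length w →
  ∑ (supports s w) (restrict (J ++ K) ψ) ≡ ∑ (supports (select J s) (select K w)) ψ
∑-supports-restrict J s [] [] ψ lenJ lenK rewrite Listₚ.++-identityʳ J =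
  cong (_+ℤ + 0) (restrict-falses J ψ s lenJ)
∑-supports-restrict J s (j ∷ K) (y ∷ w) ψ lenJ lenK = begin
  ∑ (supports s (y ∷ w)) (restrict (J ++ j ∷ K) ψ)
    ≡⟨ cong (λ L → ∑ (supports s (y ∷ w)) (restrict L ψ)) (sym (Listₚ.++-assoc J [ j ] K)) ⟩
  ∑ (supports s (y ∷ w)) (restrict ((J ++ [ j ]) ++ K) ψ)
    ≡⟨ ∑-supports-∷ s y w _ ⟩
  ∑ D (λ u → ∑ Y (restrict ((J ++ [ j ]) ++ K) ψ ∘ overlay _∨_ (close u)))
    ≡⟨ ∑-lower-cong _ _ 0 (bits s y) (λ u len → ∑-cong Y (λ v →
         restrict-overlay (J ++ [ j ]) K ψ (close u) v
           (trans (Listₚ.length-++ u) (trans (cong (ℕ._+ 1) (lenU u len)) (sym (Listₚ.length-++ J)))))) ⟩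
  ∑ D (λ u → ∑ Y (λ v → restrict (J ++ [ j ]) (λ u′ → restrict ((J ++ [ j ]) ++ K) (ψ ∘ overlay _∨_ u′) v) (close u)))
    -- With the sum over the later columns inside the outer restriction, the induction hypothesis
    -- applies to it for each fixed `u′`.
    ≡⟨ ∑-cong D (λ u → sym (restrict-∑ (J ++ [ j ]) Y _ (close u))) ⟩
  ∑ D (λ u → restrict (J ++ [ j ]) (λ u′ → ∑ Y (restrict ((J ++ [ j ]) ++ K) (ψ ∘ overlay _∨_ u′))) (close u))
    ≡⟨ ∑-cong D (λ u → restrict-cong (J ++ [ j ]) (close u) (λ u′ →
         trans (∑-supports-restrict (J ++ [ j ]) (s ++ [ y ]) K w _ lenJ′ (ℕₚ.suc-injective lenK))
               (cong (λ t → ∑ (supports t (select K w)) (ψ ∘ overlay _∨_ u′)) (select-snoc J s j y lenJ)))) ⟩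
  ∑ D (λ u → restrict (J ++ [ j ]) (λ u′ → ∑ (supports (select J s ++ select [ j ] [ y ]) (select K w)) (ψ ∘ overlay _∨_ u′)) (close u))
    ≡⟨ lastStep j ⟩
  ∑ (supports (select J s) (select (j ∷ K) (y ∷ w))) ψ ∎
  where
  open ≡-Reasoning
  D = diffs 0 (bits s y)
  Y = supports (s ++ [ y ]) w
  lenB : length (bits s y) ≡ length s
  lenB = Listₚ.length-map _ s
  lenU : ∀ u → length u ≡ length (bits s y) → length u ≡ length J
  lenU u len = trans len (trans lenB (sym lenJ))
  lenJ′ : length (J ++ [ j ]) ≡ length (s ++ [ y ])
  lenJ′ = trans (Listₚ.length-++ J) (trans (cong (ℕ._+ 1) lenJ) (sym (Listₚ.length-++ s)))
  lastStep : ∀ j →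
    ∑ D (λ u → restrict (J ++ [ j ]) (λ u′ → ∑ (supports (select J s ++ select [ j ] [ y ]) (select K w)) (ψ ∘ overlay _∨_ u′)) (close u))
    ≡ ∑ (supports (select J s) (select (j ∷ K) (y ∷ w))) ψ
  lastStep true = begin
    ∑ D (λ u → restrict (J ++ [ true ]) Ψ (close u))
      ≡⟨ ∑-lower-cong _ _ 0 (bits s y) (λ u len → restrict-snoc-true J Ψ u id (lenU u len)) ⟩
    ∑ D (restrict J (Ψ ∘ close))
      ≡⟨ ∑-diffs-restrict 0 J (bits s y) (Ψ ∘ close) (trans lenJ (sym lenB)) ⟩
    ∑ (diffs 0 (select J (bits s y))) (Ψ ∘ close)
      ≡⟨ cong (λ b → ∑ (diffs 0 b) (Ψ ∘ close)) (select-map (y <ᵇ_) J s) ⟩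
    ∑ (diffs 0 (bits (select J s) y)) (Ψ ∘ close)
      ≡⟨ sym (∑-supports-∷ (select J s) y (select K w) ψ) ⟩
    ∑ (supports (select J s) (y ∷ select K w)) ψ ∎
    where
    Ψ : List Bool → ℤ
    Ψ u′ = ∑ (supports (select J s ++ [ y ]) (select K w)) (ψ ∘ overlay _∨_ u′)
  lastStep false = begin
    ∑ D (λ u → restrict (J ++ [ false ]) Ψ (close u))
      ≡⟨ ∑-lower-cong _ _ 0 (bits s y) (λ u len → restrict-snoc-false J Ψ u (or u) (lenU u len)) ⟩
    ∑ D (unless-or (restrict J Ψ))
      ≡⟨ ∑-diffs-unless-or (bits s y) (restrict J Ψ) ⟩
    restrict J Ψ (replicate (length (bits s y)) false)
      ≡⟨ cong (λ m → restrict J Ψ (replicate m false)) lenB ⟩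
    restrict J Ψ (replicate (length s) false)
      ≡⟨ restrict-falses J Ψ s lenJ ⟩
    Ψ (replicate (length (select J s)) false)
      ≡⟨ ∑-cong (supports (select J s ++ []) (select K w)) (λ v → cong ψ (overlay-falses (length (select J s)) v)) ⟩
    ∑ (supports (select J s ++ []) (select K w)) ψ
      ≡⟨ cong (λ t → ∑ (supports t (select K w)) ψ) (Listₚ.++-identityʳ (select J s)) ⟩
    ∑ (supports (select J s) (select K w)) ψ ∎
    where
    Ψ : List Bool → ℤ
    Ψ u′ = ∑ (supports (select J s ++ []) (select K w)) (ψ ∘ overlay _∨_ u′)

-- Families with full support

full : List Bool → ℤ
full u = if and u then + 1 else + 0

fullCount : List ℕ → ℤ
fullCount w = ∑ (supports [] w) full

fullCount-nonneg : ∀ w → + 0 ≤ℤ fullCount w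
fullCount-nonneg w = ∑-nonneg (supports [] w) (λ u → 0≤if (and u))
  where
  0≤if : ∀ c → + 0 ≤ℤ (if c then + 1 else + 0)
  0≤if true  = +≤+ z≤n
  0≤if false = +≤+ z≤n

words : ℕ → List (List Bool)
words zero    = [ [] ]
words (suc n) = map (true ∷_) (words n) ++ map (false ∷_) (words n)

∑-words-suc : ∀ n φ → ∑ (words (suc n)) φ ≡ ∑ (words n) (φ ∘ (true ∷_)) +ℤ ∑ (words n) (φ ∘ (false ∷_))
∑-words-suc n φ =
  trans (∑-++ (map (true ∷_) (words n)) _ φ) (cong₂ _+ℤ_ (∑-map _ (words n) φ) (∑-map _ (words n) φ))

∑-words-cong : ∀ n {φ ψ : List Bool → ℤ} → (∀ u → length u ≡ n → φ u ≡ ψ u) →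
               ∑ (words n) φ ≡ ∑ (words n) ψ
∑-words-cong zero    eq = cong (_+ℤ + 0) (eq [] refl)
∑-words-cong (suc n) {φ} {ψ} eq =
  trans (∑-words-suc n φ)
    (trans (cong₂ _+ℤ_ (∑-words-cong n (λ u len → eq _ (cong suc len)))
                       (∑-words-cong n (λ u len → eq _ (cong suc len))))
           (sym (∑-words-suc n ψ)))

-- Containment in I together with fullness on I leaves only I = u, so each family is counted at
-- exactly one I.
∑-words-restrict-full : ∀ u → ∑ (words (length u)) (λ I → restrict I full u) ≡ + 1
∑-words-restrict-full []          = refl
∑-words-restrict-full (true ∷ u)  =
  trans (∑-words-suc (length u) _)
    (cong₂ _+ℤ_ (∑-words-restrict-full u) (∑-zero (words (length u))))
∑-words-restrict-full (false ∷ u) =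
  trans (∑-words-suc (length u) _)
    (cong₂ _+ℤ_ (trans (∑-cong (words (length u)) (λ I → restrict-zero I u)) (∑-zero (words (length u))))
                (∑-words-restrict-full u))

∑-supports-1 : ∀ w → ∑ (supports [] w) (const (+ 1)) ≡ ∑ (words (length w)) (λ I → fullCount (select I w))
∑-supports-1 w = begin
  ∑ (supports [] w) (const (+ 1))
    ≡⟨ ∑-supports-cong [] w (λ u len →
         trans (sym (∑-words-restrict-full u)) (cong (λ n → ∑ (words n) (λ I → restrict I full u)) len)) ⟩
  ∑ (supports [] w) (λ u → ∑ (words (length w)) (λ I → restrict I full u))
    ≡⟨ ∑-swap (supports [] w) (words (length w)) _ ⟩
  ∑ (words (length w)) (λ I → ∑ (supports [] w) (restrict I full))
    ≡⟨ ∑-words-cong (length w) (λ I len → ∑-supports-restrict [] [] I w full refl len) ⟩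
  ∑ (words (length w)) (λ I → fullCount (select I w)) ∎
  where open ≡-Reasoning

-- Divided differences

-- A polynomial is determined by the pairings eval p φ with functions φ of exponent vectors.
eval : Poly → (List ℕ → ℤ) → ℤ
eval p φ = ∑ p (λ t → proj₁ t *ℤ φ (proj₂ t))

∑< : (ℕ → ℤ) → ℕ → ℤ
∑< f zero    = + 0
∑< f (suc m) = ∑< f m +ℤ f m

∑<-cong : ∀ {f g} m → (∀ k → f k ≡ g k) → ∑< f m ≡ ∑< g m
∑<-cong zero    eq = refl
∑<-cong (suc m) eq = cong₂ _+ℤ_ (∑<-cong m eq) (eq m)

∑<-shift : ∀ f b m → ∑< (λ k → f (b ℕ.+ k)) m ≡ ∑< f (b ℕ.+ m) -ℤ ∑< f b
∑<-shift f b zero rewrite ℕₚ.+-identityʳ b = sym (ℤₚ.+-inverseʳ (∑< f b))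
∑<-shift f b (suc m) rewrite ℕₚ.+-suc b m | ∑<-shift f b m =
  solve 3 (λ x y z → (x :- y) :+ z := (x :+ z) :- y) refl (∑< f (b ℕ.+ m)) (∑< f b) (f (b ℕ.+ m))
  where open ℤSolver.+-*-Solver

∑-upTo : ∀ f m → ∑ (upTo m) f ≡ ∑< f m
∑-upTo f zero    = refl
∑-upTo f (suc m) = begin
  ∑ (upTo (suc m)) f          ≡⟨ cong (λ l → ∑ l f) (sym (Listₚ.upTo-∷ʳ m)) ⟩
  ∑ (upTo m ++ [ m ]) f       ≡⟨ ∑-++ (upTo m) [ m ] f ⟩
  ∑ (upTo m) f +ℤ (f m +ℤ + 0) ≡⟨ cong₂ _+ℤ_ (∑-upTo f m) (ℤₚ.+-identityʳ (f m)) ⟩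
  ∑< f m +ℤ f m               ∎
  where open ≡-Reasoning

pairAt : ℕ → (List ℕ → ℤ) → List ℕ → ℕ → ℕ → ℤ
pairAt i φ e n k = φ (setAt (setAt e i (n ∸ k)) (suc i) k)

-- The transpose of ∂_i.  All monomials of ∂_i(x^a y^b) have degree a + b - 1, so both sign cases of
-- the divided difference become one difference of partial sums.
∂* : ℕ → (List ℕ → ℤ) → List ℕ → ℤ
∂* i φ e = ∑< (pairAt i φ e (a ℕ.+ b ∸ 1)) a -ℤ ∑< (pairAt i φ e (a ℕ.+ b ∸ 1)) b
  where
  a = get e i
  b = get e (suc i)

∑-map-scaled : ∀ (c : ℤ) (E : ℕ → List ℕ) φ (F : ℕ → ℤ) b m → (∀ k → φ (E k) ≡ F (b ℕ.+ k)) →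
  eval (map (λ k → c , E k) (upTo m)) φ ≡ c *ℤ (∑< F (b ℕ.+ m) -ℤ ∑< F b)
∑-map-scaled c E φ F b m eq = begin
  eval (map (λ k → c , E k) (upTo m)) φ   ≡⟨ ∑-map _ (upTo m) _ ⟩
  ∑ (upTo m) (λ k → c *ℤ φ (E k))         ≡⟨ ∑-*ˡ (upTo m) c _ ⟩
  c *ℤ ∑ (upTo m) (φ ∘ E)                 ≡⟨ cong (c *ℤ_) (∑-upTo (φ ∘ E) m) ⟩
  c *ℤ ∑< (φ ∘ E) m                       ≡⟨ cong (c *ℤ_) (∑<-cong m eq) ⟩
  c *ℤ ∑< (λ k → F (b ℕ.+ k)) m           ≡⟨ cong (c *ℤ_) (∑<-shift F b m) ⟩
  c *ℤ (∑< F (b ℕ.+ m) -ℤ ∑< F b)         ∎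
  where open ≡-Reasoning

∸-shift : ∀ a b k → a ℕ.+ b ∸ (b ℕ.+ k) ≡ a ∸ k
∸-shift a b k = trans (cong (_∸ (b ℕ.+ k)) (ℕₚ.+-comm a b)) (ℕₚ.[m+n]∸[m+o]≡n∸o b a k)

-- Exposing a successor in the larger exponent lets the `∸ 1` in `∂*` compute. In the term with
-- index k the second exponent is k plus the smaller exponent, so the terms fill the gap between the
-- two partial sums.
eval-ddTerm : ∀ i c e φ → eval (ddTerm i (c , e)) φ ≡ c *ℤ ∂* i φ e
eval-ddTerm i c e φ with get e i | get e (suc i)
... | a | b with b <ᵇ a in eq
eval-ddTerm i c e φ | suc a | b | true =
  trans (∑-map-scaled c _ φ F b (suc a ∸ b)
           (λ k → cong (λ n → φ (setAt (setAt e i n) (suc i) (b ℕ.+ k))) (sym (∸-shift a b k))))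
        (cong (λ n → c *ℤ (∑< F n -ℤ ∑< F b)) (ℕₚ.m+[n∸m]≡n {b} {suc a} (ℕₚ.<⇒≤ (ℕₚ.<ᵇ⇒< b (suc a) (subst T (sym eq) tt)))))
  where F = pairAt i φ e (a ℕ.+ b)
eval-ddTerm i c e φ | zero | zero | false = sym (ℤₚ.*-zeroʳ c)
eval-ddTerm i c e φ | suc a | zero | false with () ← eq
eval-ddTerm i c e φ | a | suc b | false =
  trans (∑-map-scaled (neg c) _ φ F a (suc b ∸ a)
           (λ k → cong (λ n → φ (setAt (setAt e i n) (suc i) (a ℕ.+ k)))
             (sym (trans (cong (λ n → n ∸ 1 ∸ (a ℕ.+ k)) (ℕₚ.+-comm a (suc b))) (∸-shift b a k)))))
    (trans (cong (λ n → neg c *ℤ (∑< F n -ℤ ∑< F a)) (ℕₚ.m+[n∸m]≡n {a} {suc b} a≤sb))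
       (solve 3 (λ x y z → (:- x) :* (y :- z) := x :* (z :- y)) refl c (∑< F (suc b)) (∑< F a)))
  where
  open ℤSolver.+-*-Solver
  F = pairAt i φ e (a ℕ.+ suc b ∸ 1)
  a≤sb : a ≤ suc b
  a≤sb = ℕₚ.≮⇒≥ (λ lt → subst T eq (ℕₚ.<⇒<ᵇ lt))

eval-dd : ∀ i p φ → eval (dd i p) φ ≡ eval p (∂* i φ)
eval-dd i p φ =
  trans (∑-concatMap (ddTerm i) p _) (∑-cong p (λ (c , e) → eval-ddTerm i c e φ))

-- Symmetry in two adjacent variables

Long : ℕ → List ℕ → Set
Long i e = suc (suc i) ≤ length e

inc : ℕ → List ℕ → List ℕ
inc _       []      = []
inc zero    (x ∷ e) = suc x ∷ e
inc (suc i) (x ∷ e) = x ∷ inc i e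

-- `symm` is invariance of the polynomial under exchange of x_i and x_{i+1}, tested on every φ.
-- `ext` encodes that all exponent vectors of `K` reach coordinate i+1, as `swapAt i` is the
-- identity on shorter ones.
record Symmetric (i : ℕ) (K : List (List ℕ)) : Set where
  field
    ext  : ∀ {φ ψ : List ℕ → ℤ} → (∀ e → Long i e → φ e ≡ ψ e) → ∑ K φ ≡ ∑ K ψ
    symm : ∀ φ → ∑ K (φ ∘ swapAt i) ≡ ∑ K φ
open Symmetric

-- Partial sums for ∂_i(x_i x^e): the extra x_i cancels the `∸ 1` in the degree. The bound is a
-- separate argument because the summands depend on e_i and e_{i+1} only through their sum; a swap
-- of e thus moves the bound alone, and symmetry turns the bound e_i + 1 into e_{i+1} + 1.
θ : ℕ → (List ℕ → ℤ) → List ℕ → ℕ → ℤ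
θ i φ e = ∑< (pairAt i φ e (get e i ℕ.+ get e (suc i)))

∂*-inc : ∀ i φ e → Long i e → ∂* i φ (inc i e) ≡ θ i φ e (suc (get e i)) -ℤ θ i φ e (get e (suc i))
∂*-inc zero    φ (p ∷ q ∷ e) _       = refl
∂*-inc zero    φ (p ∷ [])    (s≤s ())
∂*-inc (suc i) φ (x ∷ e)     (s≤s l) = ∂*-inc i (φ ∘ (x ∷_)) e l

θ-swap : ∀ i φ e m → Long i e → θ i φ (swapAt i e) m ≡ θ i φ e m
θ-swap zero    φ (p ∷ q ∷ e) m _       = cong (λ n → ∑< (λ k → φ ((n ∸ k) ∷ k ∷ e)) m) (ℕₚ.+-comm q p)
θ-swap zero    φ (p ∷ [])    m (s≤s ())
θ-swap (suc i) φ (x ∷ e)     m (s≤s l) = θ-swap i (φ ∘ (x ∷_)) e m l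

θ-inc-swap : ∀ i φ e m → Long i e → θ i φ (inc (suc i) (swapAt i e)) m ≡ θ i φ (inc (suc i) e) m
θ-inc-swap zero    φ (p ∷ q ∷ e) m _       =
  cong (λ n → ∑< (λ k → φ ((n ∸ k) ∷ k ∷ e)) m)
    (trans (ℕₚ.+-suc q p) (trans (cong suc (ℕₚ.+-comm q p)) (sym (ℕₚ.+-suc p q))))
θ-inc-swap zero    φ (p ∷ [])    m (s≤s ())
θ-inc-swap (suc i) φ (x ∷ e)     m (s≤s l) = θ-inc-swap i (φ ∘ (x ∷_)) e m l

-- The summand at k = e_{i+1} is x^e itself, the one term left of ∂_i(x_i x^e) after symmetrisation.
θ-suc : ∀ i φ e → Long i e → θ i φ e (suc (get e (suc i))) ≡ θ i φ e (get e (suc i)) +ℤ φ e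
θ-suc zero    φ (p ∷ q ∷ e) _       =
  cong (λ n → θ zero φ (p ∷ q ∷ e) q +ℤ φ (n ∷ q ∷ e)) (ℕₚ.m+n∸n≡m p q)
θ-suc zero    φ (p ∷ [])    (s≤s ())
θ-suc (suc i) φ (x ∷ e)     (s≤s l) = θ-suc i (φ ∘ (x ∷_)) e l

get-swap : ∀ i e → Long i e → get (swapAt i e) (suc i) ≡ get e i
get-swap zero    (p ∷ q ∷ e) _       = refl
get-swap zero    (p ∷ [])    (s≤s ())
get-swap (suc i) (x ∷ e)     (s≤s l) = get-swap i e l

get-inc-left : ∀ i e → get (inc (suc i) e) i ≡ get e i
get-inc-left i       []      = refl
get-inc-left zero    (x ∷ e) = refl
get-inc-left (suc i) (x ∷ e) = get-inc-left i e

get-inc : ∀ i e → i < length e → get (inc i e) i ≡ suc (get e i)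
get-inc zero    (x ∷ e) _       = refl
get-inc (suc i) (x ∷ e) (s≤s l) = get-inc i e l

length-inc : ∀ i e → length (inc i e) ≡ length e
length-inc i       []      = refl
length-inc zero    (x ∷ e) = refl
length-inc (suc i) (x ∷ e) = cong suc (length-inc i e)

-- ∂_i(x_i g) = g for g symmetric in x_i, x_{i+1}.
∑-∂*-inc : ∀ {i K} → Symmetric i K → ∀ φ → ∑ K (∂* i φ ∘ inc i) ≡ ∑ K φ
∑-∂*-inc {i} {K} S φ = begin
  ∑ K (∂* i φ ∘ inc i)
    ≡⟨ ext S (λ e l → trans (∂*-inc i φ e l) (cong (_-ℤ θ i φ e (get e (suc i))) (sym (χ-swap e l)))) ⟩
  ∑ K (λ e → χ (swapAt i e) -ℤ θ i φ e (get e (suc i)))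
    ≡⟨ ∑-distrib-- K _ _ ⟩
  ∑ K (χ ∘ swapAt i) -ℤ ∑ K (λ e → θ i φ e (get e (suc i)))
    ≡⟨ cong (_-ℤ ∑ K (λ e → θ i φ e (get e (suc i)))) (symm S χ) ⟩
  ∑ K χ -ℤ ∑ K (λ e → θ i φ e (get e (suc i)))
    ≡⟨ sym (∑-distrib-- K _ _) ⟩
  ∑ K (λ e → χ e -ℤ θ i φ e (get e (suc i)))
    ≡⟨ ext S (λ e l → trans (cong (_-ℤ θ i φ e (get e (suc i))) (θ-suc i φ e l))
         (solve 2 (λ x y → (x :+ y) :- x := y) refl (θ i φ e (get e (suc i))) (φ e))) ⟩
  ∑ K φ ∎
  where
  open ≡-Reasoning
  open ℤSolver.+-*-Solver
  χ : List ℕ → ℤ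
  χ e = θ i φ e (suc (get e (suc i)))
  χ-swap : ∀ e → Long i e → χ (swapAt i e) ≡ θ i φ e (suc (get e i))
  χ-swap e l = trans (θ-swap i φ e (suc (get (swapAt i e) (suc i))) l) (cong (θ i φ e ∘ suc) (get-swap i e l))

-- ∂_i(x_i x_{i+1} g) = 0 for g symmetric in x_i, x_{i+1}.
∑-∂*-inc-inc : ∀ {i K} → Symmetric i K → ∀ φ → ∑ K (∂* i φ ∘ inc i ∘ inc (suc i)) ≡ + 0
∑-∂*-inc-inc {i} {K} S φ = begin
  ∑ K (∂* i φ ∘ inc i ∘ inc (suc i))
    ≡⟨ ext S (λ e l → trans (∂*-inc i φ (inc (suc i) e) (subst (suc (suc i) ≤_) (sym (length-inc (suc i) e)) l))
         (cong₂ (λ m n → θ i φ (inc (suc i) e) m -ℤ θ i φ (inc (suc i) e) n)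
                (cong suc (get-inc-left i e)) (get-inc (suc i) e l))) ⟩
  ∑ K (λ e → θ i φ (inc (suc i) e) (suc (get e i)) -ℤ χ e)
    ≡⟨ ext S (λ e l → cong (_-ℤ χ e) (sym (χ-swap e l))) ⟩
  ∑ K (λ e → χ (swapAt i e) -ℤ χ e)
    ≡⟨ ∑-distrib-- K _ _ ⟩
  ∑ K (χ ∘ swapAt i) -ℤ ∑ K χ
    ≡⟨ cong (_-ℤ ∑ K χ) (symm S χ) ⟩
  ∑ K χ -ℤ ∑ K χ
    ≡⟨ ℤₚ.+-inverseʳ (∑ K χ) ⟩
  + 0 ∎
  where
  open ≡-Reasoning
  χ : List ℕ → ℤ
  χ e = θ i φ (inc (suc i) e) (suc (get e (suc i)))
  χ-swap : ∀ e → Long i e → χ (swapAt i e) ≡ θ i φ (inc (suc i) e) (suc (get e i))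
  χ-swap e l = trans (θ-inc-swap i φ e (suc (get (swapAt i e) (suc i))) l) (cong (θ i φ (inc (suc i) e) ∘ suc) (get-swap i e l))

Symmetric-[] : ∀ {i} → Symmetric i []
Symmetric-[] .ext  _ = refl
Symmetric-[] .symm _ = refl

Symmetric-++ : ∀ {i K L} → Symmetric i K → Symmetric i L → Symmetric i (K ++ L)
Symmetric-++ {i} {K} {L} S T .ext {φ} {ψ} eq =
  trans (∑-++ K L φ) (trans (cong₂ _+ℤ_ (ext S eq) (ext T eq)) (sym (∑-++ K L ψ)))
Symmetric-++ {i} {K} {L} S T .symm φ =
  trans (∑-++ K L _) (trans (cong₂ _+ℤ_ (symm S φ) (symm T φ)) (sym (∑-++ K L φ)))

Symmetric-∷ : ∀ {i K} c → Symmetric i K → Symmetric (suc i) (map (c ∷_) K)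
Symmetric-∷ {i} {K} c S .ext {φ} {ψ} eq =
  trans (∑-map _ K φ) (trans (ext S (λ e l → eq _ (s≤s l))) (sym (∑-map _ K ψ)))
Symmetric-∷ {i} {K} c S .symm φ =
  trans (∑-map _ K _) (trans (symm S (φ ∘ (c ∷_))) (sym (∑-map _ K φ)))

infixr 6 _⊕_
_⊕_ : List ℕ → List ℕ → List ℕ
_⊕_ = overlay ℕ._+_

mul : List (List ℕ) → List (List ℕ) → List (List ℕ)
mul K L = concatMap (λ u → map (u ⊕_) L) K

∑-mul : ∀ K L φ → ∑ (mul K L) φ ≡ ∑ K (λ u → ∑ L (λ v → φ (u ⊕ v)))
∑-mul K L φ = trans (∑-concatMap _ K φ) (∑-cong K (λ u → ∑-map _ L φ))

swapAt-⊕ : ∀ i u v → Long i u → Long i v → swapAt i (u ⊕ v) ≡ swapAt i u ⊕ swapAt i v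
swapAt-⊕ zero    (a ∷ b ∷ u) (c ∷ d ∷ v) _        _        = refl
swapAt-⊕ zero    (a ∷ [])    v           (s≤s ()) _
swapAt-⊕ zero    (a ∷ b ∷ u) (c ∷ [])    _        (s≤s ())
swapAt-⊕ (suc i) (a ∷ u)     (c ∷ v)     (s≤s l)  (s≤s m)  = cong (_ ∷_) (swapAt-⊕ i u v l m)

Symmetric-mul : ∀ {i K L} → Symmetric i K → Symmetric i L → Symmetric i (mul K L)
Symmetric-mul {i} {K} {L} S T .ext {φ} {ψ} eq =
  trans (∑-mul K L φ)
    (trans (∑-cong K (λ u → ext T (λ v l → eq _ (subst (suc (suc i) ≤_) (sym (length-overlay ℕ._+_ u v)) l))))
           (sym (∑-mul K L ψ)))
Symmetric-mul {i} {K} {L} S T .symm φ = begin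
  ∑ (mul K L) (φ ∘ swapAt i)
    ≡⟨ ∑-mul K L _ ⟩
  ∑ K (λ u → ∑ L (λ v → φ (swapAt i (u ⊕ v))))
    ≡⟨ ext S (λ u l → ext T (λ v m → cong φ (swapAt-⊕ i u v l m))) ⟩
  ∑ K (λ u → ∑ L (λ v → φ (swapAt i u ⊕ swapAt i v)))
    ≡⟨ ∑-cong K (λ u → symm T (λ v → φ (swapAt i u ⊕ v))) ⟩
  ∑ K (λ u → ∑ L (λ v → φ (swapAt i u ⊕ v)))
    ≡⟨ symm S (λ u → ∑ L (λ v → φ (u ⊕ v))) ⟩
  ∑ K (λ u → ∑ L (λ v → φ (u ⊕ v)))
    ≡⟨ sym (∑-mul K L φ) ⟩
  ∑ (mul K L) φ ∎
  where open ≡-Reasoning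

-- Products of columns

keepℕ flipℕ : Bool → ℕ
keepℕ d = if d then 1 else 0
flipℕ d = if d then 0 else 1

cols : ℕ → List Bool → List (List ℕ)
cols = lower keepℕ flipℕ

-- The exponent vectors of the product of the column polynomials Σ_{C ≤ D_p} x^C, p ranging over the
-- positions of w in s ++ w.
terms : List ℕ → List ℕ → List (List ℕ)
terms s []      = [ replicate (length s) 0 ]
terms s (y ∷ w) = mul (cols 0 (bits s y)) (terms (s ++ [ y ]) w)

∑-terms-1 : ∀ s w → ∑ (terms s w) (const (+ 1)) ≡ ∑ (supports s w) (const (+ 1))
∑-terms-1 s []      = refl
∑-terms-1 s (y ∷ w) =
  trans (∑-mul (cols 0 (bits s y)) _ _)
    (trans (∑-lower-const 0 (bits s y) _)
      (trans (∑-cong (diffs 0 (bits s y)) (λ _ → ∑-terms-1 (s ++ [ y ]) w))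
             (sym (∑-supports-∷ s y w _))))

-- Exchanging two adjacent entries of the prefix

data Adj (a b : ℕ) : ℕ → List ℕ → List ℕ → Set where
  here  : ∀ {m} → Adj a b 0 (b ∷ a ∷ m) (a ∷ b ∷ m)
  there : ∀ {i x t t′} → Adj a b i t t′ → Adj a b (suc i) (x ∷ t) (x ∷ t′)

Adj-snoc : ∀ {a b i t t′} y → Adj a b i t t′ → Adj a b i (t ++ [ y ]) (t′ ++ [ y ])
Adj-snoc y here      = here
Adj-snoc y (there p) = there (Adj-snoc y p)

Adj-snoc² : ∀ a b s → Adj a b (length s) ((s ++ [ b ]) ++ [ a ]) ((s ++ [ a ]) ++ [ b ])
Adj-snoc² a b []      = here
Adj-snoc² a b (x ∷ s) = there (Adj-snoc² a b s)

Adj-long : ∀ {a b i t t′} → Adj a b i t t′ → Long i t′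
Adj-long here      = s≤s (s≤s z≤n)
Adj-long (there p) = s≤s (Adj-long p)

private
  ∑-cols-false = ∑-lower-false keepℕ flipℕ
  ∑-cols-true₀ = ∑-lower-true₀ keepℕ flipℕ
  ∑-cols-true₊ = ∑-lower-true₊ keepℕ flipℕ

  -- The names list the first two letters of the column word, the subscript the surplus before them.
  -- Summands are missing exactly where C would make the surplus negative.
  module Two (b : List Bool) (φ : List ℕ → ℤ) where
    val : ℕ → ℕ → ℕ → ℤ
    val k c d = ∑ (cols k b) (λ u → φ (c ∷ d ∷ u))

    ff : ∀ k → ∑ (cols k (false ∷ false ∷ b)) φ ≡
         (val k 0 0 +ℤ val (suc k) 0 1) +ℤ (val (suc k) 1 0 +ℤ val (suc (suc k)) 1 1)
    ff k = trans (∑-cols-false k (false ∷ b) φ) (cong₂ _+ℤ_ (∑-cols-false k b (φ ∘ (0 ∷_))) (∑-cols-false (suc k) b (φ ∘ (1 ∷_))))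

    ft₀ : ∑ (cols 0 (false ∷ true ∷ b)) φ ≡ val 0 0 1 +ℤ (val 1 1 1 +ℤ val 0 1 0)
    ft₀ = trans (∑-cols-false 0 (true ∷ b) φ) (cong₂ _+ℤ_ (∑-cols-true₀ b (φ ∘ (0 ∷_))) (∑-cols-true₊ 0 b (φ ∘ (1 ∷_))))

    ft₊ : ∀ k → ∑ (cols (suc k) (false ∷ true ∷ b)) φ ≡
          (val (suc k) 0 1 +ℤ val k 0 0) +ℤ (val (suc (suc k)) 1 1 +ℤ val (suc k) 1 0)
    ft₊ k = trans (∑-cols-false (suc k) (true ∷ b) φ) (cong₂ _+ℤ_ (∑-cols-true₊ k b (φ ∘ (0 ∷_))) (∑-cols-true₊ (suc k) b (φ ∘ (1 ∷_))))

    tf₀ : ∑ (cols 0 (true ∷ false ∷ b)) φ ≡ val 0 1 0 +ℤ val 1 1 1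
    tf₀ = trans (∑-cols-true₀ (false ∷ b) φ) (∑-cols-false 0 b (φ ∘ (1 ∷_)))

    tf₊ : ∀ k → ∑ (cols (suc k) (true ∷ false ∷ b)) φ ≡
          (val (suc k) 1 0 +ℤ val (suc (suc k)) 1 1) +ℤ (val k 0 0 +ℤ val (suc k) 0 1)
    tf₊ k = trans (∑-cols-true₊ k (false ∷ b) φ) (cong₂ _+ℤ_ (∑-cols-false (suc k) b (φ ∘ (1 ∷_))) (∑-cols-false k b (φ ∘ (0 ∷_))))

    tt₀ : ∑ (cols 0 (true ∷ true ∷ b)) φ ≡ val 0 1 1
    tt₀ = trans (∑-cols-true₀ (true ∷ b) φ) (∑-cols-true₀ b (φ ∘ (1 ∷_)))

    tt₁ : ∑ (cols 1 (true ∷ true ∷ b)) φ ≡ (val 1 1 1 +ℤ val 0 1 0) +ℤ val 0 0 1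
    tt₁ = trans (∑-cols-true₊ 0 (true ∷ b) φ) (cong₂ _+ℤ_ (∑-cols-true₊ 0 b (φ ∘ (1 ∷_))) (∑-cols-true₀ b (φ ∘ (0 ∷_))))

    tt₂ : ∀ k → ∑ (cols (suc (suc k)) (true ∷ true ∷ b)) φ ≡
          (val (suc (suc k)) 1 1 +ℤ val (suc k) 1 0) +ℤ (val (suc k) 0 1 +ℤ val k 0 0)
    tt₂ k = trans (∑-cols-true₊ (suc k) (true ∷ b) φ) (cong₂ _+ℤ_ (∑-cols-true₊ (suc k) b (φ ∘ (1 ∷_))) (∑-cols-true₊ k b (φ ∘ (0 ∷_))))

-- The surplus after both letters depends only on the number of ones of C among them. Symmetry can
-- thus fail only where one of 01, 10 is forbidden for C and the other is not; this happens only
-- over the letters 10 at surplus 0, and the implication excludes those letters.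
∑-cols-swap₀ : ∀ k d₁ d₂ b φ → (d₁ ≡ true → d₂ ≡ true) →
               ∑ (cols k (d₁ ∷ d₂ ∷ b)) (φ ∘ swapAt 0) ≡ ∑ (cols k (d₁ ∷ d₂ ∷ b)) φ
∑-cols-swap₀ k false false b φ _ =
  trans (Two.ff b (φ ∘ swapAt 0) k)
    (trans (+-interchange (val k 0 0) (val (suc k) 1 0) (val (suc k) 0 1) (val (suc (suc k)) 1 1)) (sym (ff k)))
  where open Two b φ
∑-cols-swap₀ zero false true b φ _ =
  trans (Two.ft₀ b (φ ∘ swapAt 0))
    (trans (solve 3 (λ x y z → x :+ (y :+ z) := z :+ (y :+ x)) refl (val 0 1 0) (val 1 1 1) (val 0 0 1)) (sym ft₀))
  where
  open Two b φ
  open ℤSolver.+-*-Solver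
∑-cols-swap₀ (suc k) false true b φ _ =
  trans (Two.ft₊ b (φ ∘ swapAt 0) k)
    (trans (solve 4 (λ x w y z → (x :+ w) :+ (y :+ z) := (z :+ w) :+ (y :+ x)) refl
             (val (suc k) 1 0) (val k 0 0) (val (suc (suc k)) 1 1) (val (suc k) 0 1)) (sym (ft₊ k)))
  where
  open Two b φ
  open ℤSolver.+-*-Solver
∑-cols-swap₀ k true false b φ imp with () ← imp refl
∑-cols-swap₀ zero true true b φ _ = trans (Two.tt₀ b (φ ∘ swapAt 0)) (sym (Two.tt₀ b φ))
∑-cols-swap₀ (suc zero) true true b φ _ =
  trans (Two.tt₁ b (φ ∘ swapAt 0))
    (trans (solve 3 (λ x y z → (x :+ y) :+ z := (x :+ z) :+ y) refl (val 1 1 1) (val 0 0 1) (val 0 1 0)) (sym tt₁))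
  where
  open Two b φ
  open ℤSolver.+-*-Solver
∑-cols-swap₀ (suc (suc k)) true true b φ _ =
  trans (Two.tt₂ b (φ ∘ swapAt 0) k)
    (trans (+-interchange (val (suc (suc k)) 1 1) (val (suc k) 0 1) (val (suc k) 1 0) (val k 0 0)) (sym (tt₂ k)))
  where open Two b φ

<⇒<ᵇ≡true : ∀ {m n} → m < n → (m <ᵇ n) ≡ true
<⇒<ᵇ≡true {m} {n} lt with m <ᵇ n in eq
... | true  = refl
... | false = ⊥-elim (subst T eq (ℕₚ.<⇒<ᵇ lt))

≤⇒<ᵇ≡false : ∀ {m n} → n ≤ m → (m <ᵇ n) ≡ false
≤⇒<ᵇ≡false {m} {n} le with m <ᵇ n in eq
... | false = refl
... | true  = ⊥-elim (ℕₚ.<⇒≱ (ℕₚ.<ᵇ⇒< m n (subst T (sym eq) tt)) le)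

<ᵇ≡true⇒< : ∀ {m n} → (m <ᵇ n) ≡ true → m < n
<ᵇ≡true⇒< {m} {n} eq = ℕₚ.<ᵇ⇒< m n (subst T (sym eq) tt)

<ᵇ≡false⇒≤ : ∀ {m n} → (m <ᵇ n) ≡ false → n ≤ m
<ᵇ≡false⇒≤ {m} {n} eq = ℕₚ.≮⇒≥ (λ lt → subst T eq (ℕₚ.<⇒<ᵇ lt))

∑-cols-swap : ∀ {a b i t t′} → a < b → Adj a b i t t′ → ∀ k y φ →
              ∑ (cols k (bits t′ y)) (φ ∘ swapAt i) ≡ ∑ (cols k (bits t′ y)) φ
∑-cols-swap {a} {b} a<b here k y φ =
  ∑-cols-swap₀ k (y <ᵇ a) (y <ᵇ b) _ φ (λ eq → <⇒<ᵇ≡true (ℕₚ.<-trans (<ᵇ≡true⇒< eq) a<b))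
∑-cols-swap {i = suc i} {t′ = x ∷ t′} a<b (there p) k y φ with y <ᵇ x
∑-cols-swap {i = suc i} {t′ = x ∷ t′} a<b (there p) k y φ | false =
  trans (∑-cols-false k (bits t′ y) _)
    (trans (cong₂ _+ℤ_ (∑-cols-swap a<b p k y _) (∑-cols-swap a<b p (suc k) y _))
           (sym (∑-cols-false k (bits t′ y) φ)))
∑-cols-swap {i = suc i} {t′ = x ∷ t′} a<b (there p) zero y φ | true =
  trans (∑-cols-true₀ (bits t′ y) _)
    (trans (∑-cols-swap a<b p zero y _) (sym (∑-cols-true₀ (bits t′ y) φ)))
∑-cols-swap {i = suc i} {t′ = x ∷ t′} a<b (there p) (suc k) y φ | true =
  trans (∑-cols-true₊ k (bits t′ y) _)
    (trans (cong₂ _+ℤ_ (∑-cols-swap a<b p (suc k) y _) (∑-cols-swap a<b p k y _))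
           (sym (∑-cols-true₊ k (bits t′ y) φ)))

cols-symmetric : ∀ {a b i t t′} → a < b → Adj a b i t t′ → ∀ k y → Symmetric i (cols k (bits t′ y))
cols-symmetric {t′ = t′} a<b p k y .ext eq =
  ∑-lower-cong keepℕ flipℕ k (bits t′ y) (λ u len →
    eq u (subst (_ ≤_) (sym (trans len (Listₚ.length-map _ t′))) (Adj-long p)))
cols-symmetric a<b p k y .symm φ = ∑-cols-swap a<b p k y φ

swapAt-replicate : ∀ i n → swapAt i (replicate n 0) ≡ replicate n 0
swapAt-replicate zero    zero          = refl
swapAt-replicate zero    (suc zero)    = refl
swapAt-replicate zero    (suc (suc n)) = refl
swapAt-replicate (suc i) zero          = refl
swapAt-replicate (suc i) (suc n)       = cong (0 ∷_) (swapAt-replicate i n)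

terms-symmetric : ∀ {a b i t t′} → a < b → Adj a b i t t′ → ∀ w → Symmetric i (terms t′ w)
terms-symmetric {t′ = t′} a<b p []      .ext eq =
  cong (_+ℤ + 0) (eq _ (subst (_ ≤_) (sym (Listₚ.length-replicate (length t′))) (Adj-long p)))
terms-symmetric {i = i} {t′ = t′} a<b p []      .symm φ = cong (λ e → φ e +ℤ + 0) (swapAt-replicate i (length t′))
terms-symmetric a<b p (y ∷ w) =
  Symmetric-mul (cols-symmetric a<b p 0 y) (terms-symmetric a<b (Adj-snoc y p) w)

-- K′ = K + x_{i+1} h with h symmetric. Then x_i K and x_i K′ have the same image under ∂_i, since
-- ∂_i(x_i x_{i+1} h) = 0.
Excess : ℕ → List (List ℕ) → List (List ℕ) → Set
Excess i K′ K = ∃ λ h → Symmetric i h × (∀ φ → ∑ K′ φ ≡ ∑ K φ +ℤ ∑ h (φ ∘ inc (suc i)))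

-- Straightening a column with letters 10 into 01 adds x_{i+1} times a symmetric polynomial: the
-- words with letters 01 at surplus 0.
cols-excess : ∀ {a b i t t′} → Adj a b i t t′ → ∀ k y → (y <ᵇ a) ≡ false → (y <ᵇ b) ≡ true →
              Excess i (cols k (bits t′ y)) (cols k (bits t y))
cols-excess (here {m}) zero y ea eb rewrite ea | eb =
  map (λ u → 0 ∷ 0 ∷ u) X , symmetric , split
  where
  X = cols 0 (bits m y)
  symmetric : Symmetric 0 (map (λ u → 0 ∷ 0 ∷ u) X)
  symmetric .ext {φ} {ψ} eq =
    trans (∑-map _ X φ) (trans (∑-cong X (λ u → eq _ (s≤s (s≤s z≤n)))) (sym (∑-map _ X ψ)))
  symmetric .symm φ = trans (∑-map _ X _) (sym (∑-map _ X φ))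
  split : ∀ φ → ∑ (cols 0 (false ∷ true ∷ bits m y)) φ ≡
          ∑ (cols 0 (true ∷ false ∷ bits m y)) φ +ℤ ∑ (map (λ u → 0 ∷ 0 ∷ u) X) (φ ∘ inc 1)
  split φ =
    trans ft₀
      (trans (solve 3 (λ x z v → x :+ (z :+ v) := (v :+ z) :+ x) refl (val 0 0 1) (val 1 1 1) (val 0 1 0))
             (cong₂ _+ℤ_ (sym tf₀) (sym (∑-map _ X _))))
    where
    open Two (bits m y) φ
    open ℤSolver.+-*-Solver
cols-excess (here {m}) (suc k) y ea eb rewrite ea | eb = [] , Symmetric-[] , split
  where
  split : ∀ φ → ∑ (cols (suc k) (false ∷ true ∷ bits m y)) φ ≡
          ∑ (cols (suc k) (true ∷ false ∷ bits m y)) φ +ℤ + 0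
  split φ =
    trans (ft₊ k)
      (trans (solve 4 (λ x w z v → (x :+ w) :+ (z :+ v) := ((v :+ z) :+ (w :+ x)) :+ con (+ 0)) refl
                (val (suc k) 0 1) (val k 0 0) (val (suc (suc k)) 1 1) (val (suc k) 1 0))
             (cong (_+ℤ + 0) (sym (tf₊ k))))
    where
    open Two (bits m y) φ
    open ℤSolver.+-*-Solver
cols-excess (there {i} {x} {t} {t′} p) k y ea eb with y <ᵇ x
cols-excess (there {i} {x} {t} {t′} p) k y ea eb | false
  with h₀ , S₀ , eq₀ ← cols-excess p k y ea eb | h₁ , S₁ , eq₁ ← cols-excess p (suc k) y ea eb =
  map (0 ∷_) h₀ ++ map (1 ∷_) h₁ , Symmetric-++ (Symmetric-∷ 0 S₀) (Symmetric-∷ 1 S₁) , λ φ →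
    trans (∑-cols-false k (bits t′ y) φ)
      (trans (cong₂ _+ℤ_ (eq₀ _) (eq₁ _))
        (trans (+-interchange (∑ (cols k (bits t y)) (φ ∘ (0 ∷_))) _ _ _)
          (cong₂ _+ℤ_ (sym (∑-cols-false k (bits t y) φ))
            (sym (trans (∑-++ (map (0 ∷_) h₀) _ _) (cong₂ _+ℤ_ (∑-map _ h₀ _) (∑-map _ h₁ _)))))))
cols-excess (there {i} {x} {t} {t′} p) zero y ea eb | true
  with h₀ , S₀ , eq₀ ← cols-excess p zero y ea eb =
  map (1 ∷_) h₀ , Symmetric-∷ 1 S₀ , λ φ →
    trans (∑-cols-true₀ (bits t′ y) φ)
      (trans (eq₀ _) (cong₂ _+ℤ_ (sym (∑-cols-true₀ (bits t y) φ)) (sym (∑-map _ h₀ _))))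
cols-excess (there {i} {x} {t} {t′} p) (suc k) y ea eb | true
  with h₀ , S₀ , eq₀ ← cols-excess p (suc k) y ea eb | h₁ , S₁ , eq₁ ← cols-excess p k y ea eb =
  map (1 ∷_) h₀ ++ map (0 ∷_) h₁ , Symmetric-++ (Symmetric-∷ 1 S₀) (Symmetric-∷ 0 S₁) , λ φ →
    trans (∑-cols-true₊ k (bits t′ y) φ)
      (trans (cong₂ _+ℤ_ (eq₀ _) (eq₁ _))
        (trans (+-interchange (∑ (cols (suc k) (bits t y)) (φ ∘ (1 ∷_))) _ _ _)
          (cong₂ _+ℤ_ (sym (∑-cols-true₊ k (bits t y) φ))
            (sym (trans (∑-++ (map (1 ∷_) h₀) _ _) (cong₂ _+ℤ_ (∑-map _ h₀ _) (∑-map _ h₁ _)))))))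

SameSide : ℕ → ℕ → ℕ → Set
SameSide a b y = (y <ᵇ a) ≡ (y <ᵇ b)

data AtMostOneBetween (a b : ℕ) : List ℕ → Set where
  []   : AtMostOneBetween a b []
  skip : ∀ {y w} → SameSide a b y → AtMostOneBetween a b w → AtMostOneBetween a b (y ∷ w)
  one  : ∀ {y w} → (y <ᵇ a) ≡ false → (y <ᵇ b) ≡ true → All (SameSide a b) w →
         AtMostOneBetween a b (y ∷ w)

bits-Adj : ∀ {a b i t t′ y} → Adj a b i t t′ → SameSide a b y → bits t y ≡ bits t′ y
bits-Adj {y = y} (here {m}) eq = cong₂ (λ c d → c ∷ d ∷ bits m y) (sym eq) eq
bits-Adj (there p) eq = cong (_ ∷_) (bits-Adj p eq)

terms-Adj : ∀ {a b i t t′ w} → Adj a b i t t′ → All (SameSide a b) w → terms t w ≡ terms t′ w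
terms-Adj {w = []}    here      []         = refl
terms-Adj {w = []}    (there p) []         = cong (λ n → [ 0 ∷ replicate n 0 ]) (Adj-length p)
  where
  Adj-length : ∀ {a b i t t′} → Adj a b i t t′ → length t ≡ length t′
  Adj-length here      = refl
  Adj-length (there p) = cong suc (Adj-length p)
terms-Adj {w = y ∷ w} p         (eq ∷ eqs) =
  cong₂ (λ c K → mul (cols 0 c) K) (bits-Adj p eq) (terms-Adj (Adj-snoc y p) eqs)

⊕-inc : ∀ j u v → u ⊕ inc j v ≡ inc j (u ⊕ v)
⊕-inc j       []      v       = refl
⊕-inc j       (x ∷ u) []      = refl
⊕-inc zero    (x ∷ u) (y ∷ v) = cong (_∷ (u ⊕ v)) (ℕₚ.+-suc x y)
⊕-inc (suc j) (x ∷ u) (y ∷ v) = cong (x ℕ.+ y ∷_) (⊕-inc j u v)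

inc-⊕ : ∀ j u v → j < length u → inc j u ⊕ v ≡ inc j (u ⊕ v)
inc-⊕ zero    (x ∷ u) []      _       = refl
inc-⊕ (suc j) (x ∷ u) []      _       = refl
inc-⊕ zero    (x ∷ u) (y ∷ v) _       = refl
inc-⊕ (suc j) (x ∷ u) (y ∷ v) (s≤s l) = cong (x ℕ.+ y ∷_) (inc-⊕ j u v l)

-- A column common to both prefixes is symmetric and simply multiplies h. At the one column that
-- changes, its own excess multiplies the product of the remaining columns, which is symmetric and
-- the same for both prefixes, so x_{i+1} enters only once.
terms-excess : ∀ {a b i t t′ w} → a < b → Adj a b i t t′ → AtMostOneBetween a b w →
               Excess i (terms t′ w) (terms t w)
terms-excess {w = []} a<b p [] = [] , Symmetric-[] , λ φ →
  trans (cong (λ K → ∑ K φ) (sym (terms-Adj p []))) (sym (ℤₚ.+-identityʳ _))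
terms-excess {i = i} {t} {t′} {y ∷ w} a<b p (skip eq am)
  with h , S , eqh ← terms-excess a<b (Adj-snoc y p) am =
  mul C h , Symmetric-mul (cols-symmetric a<b p 0 y) S , λ φ → begin
    ∑ (terms t′ (y ∷ w)) φ
      ≡⟨ ∑-mul C (terms (t′ ++ [ y ]) w) φ ⟩
    ∑ C (λ u → ∑ (terms (t′ ++ [ y ]) w) (φ ∘ (u ⊕_)))
      ≡⟨ ∑-cong C (λ u → eqh (φ ∘ (u ⊕_))) ⟩
    ∑ C (λ u → ∑ (terms (t ++ [ y ]) w) (φ ∘ (u ⊕_)) +ℤ ∑ h (λ v → φ (u ⊕ inc (suc i) v)))
      ≡⟨ ∑-distrib-+ C _ _ ⟩
    ∑ C (λ u → ∑ (terms (t ++ [ y ]) w) (φ ∘ (u ⊕_))) +ℤ ∑ C (λ u → ∑ h (λ v → φ (u ⊕ inc (suc i) v)))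
      ≡⟨ cong₂ _+ℤ_
           (trans (sym (∑-mul C (terms (t ++ [ y ]) w) φ))
                  (cong (λ c → ∑ (mul (cols 0 c) (terms (t ++ [ y ]) w)) φ) (sym (bits-Adj p eq))))
           (trans (∑-cong C (λ u → ∑-cong h (λ v → cong φ (⊕-inc (suc i) u v)))) (sym (∑-mul C h _))) ⟩
    ∑ (terms t (y ∷ w)) φ +ℤ ∑ (mul C h) (φ ∘ inc (suc i)) ∎
  where
  open ≡-Reasoning
  C = cols 0 (bits t′ y)
terms-excess {i = i} {t} {t′} {y ∷ w} a<b p (one ea eb same)
  with h , S , eqh ← cols-excess p 0 y ea eb =
  mul h R , Symmetric-mul S (terms-symmetric a<b (Adj-snoc y p) w) , λ φ → begin
    ∑ (terms t′ (y ∷ w)) φ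
      ≡⟨ ∑-mul (cols 0 (bits t′ y)) R φ ⟩
    ∑ (cols 0 (bits t′ y)) (λ u → ∑ R (φ ∘ (u ⊕_)))
      ≡⟨ eqh _ ⟩
    ∑ (cols 0 (bits t y)) (λ u → ∑ R (φ ∘ (u ⊕_))) +ℤ ∑ h (λ u → ∑ R (φ ∘ (inc (suc i) u ⊕_)))
      ≡⟨ cong₂ _+ℤ_
           (trans (sym (∑-mul (cols 0 (bits t y)) R φ))
                  (cong (λ K → ∑ (mul (cols 0 (bits t y)) K) φ) (sym (terms-Adj (Adj-snoc y p) same))))
           (trans (ext S (λ u l → ∑-cong R (λ v → cong φ (inc-⊕ (suc i) u v l)))) (sym (∑-mul h R _))) ⟩
    ∑ (terms t (y ∷ w)) φ +ℤ ∑ (mul h R) (φ ∘ inc (suc i)) ∎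
  where
  open ≡-Reasoning
  R = terms (t′ ++ [ y ]) w

∑-terms-∂*-inc : ∀ {a b i t t′ w} → a < b → Adj a b i t t′ → AtMostOneBetween a b w → ∀ φ →
                 ∑ (terms t w) (∂* i φ ∘ inc i) ≡ ∑ (terms t′ w) φ
∑-terms-∂*-inc {i = i} {t} {t′} {w} a<b p am φ
  with h , S , eqh ← terms-excess a<b p am = begin
  ∑ (terms t w) G                                  ≡⟨ sym (ℤₚ.+-identityʳ _) ⟩
  ∑ (terms t w) G +ℤ + 0                           ≡⟨ cong (∑ (terms t w) G +ℤ_) (sym (∑-∂*-inc-inc S φ)) ⟩
  ∑ (terms t w) G +ℤ ∑ h (G ∘ inc (suc i))         ≡⟨ sym (eqh G) ⟩
  ∑ (terms t′ w) G                                 ≡⟨ ∑-∂*-inc (terms-symmetric a<b p w) φ ⟩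
  ∑ (terms t′ w) φ                                 ∎
  where
  open ≡-Reasoning
  G = ∂* i φ ∘ inc i

Unique-resp-↭ : {xs ys : List ℕ} → xs ↭ ys → Unique xs → Unique ys
Unique-resp-↭ p = PermSₚ.Unique-resp-↭ (setoid ℕ) (↭⇒↭ₛ p)

-- The first ascent

bits-all : ∀ {y} s → All (y <_) s → bits s y ≡ replicate (length s) true
bits-all []      []       = refl
bits-all (x ∷ s) (p ∷ ps) = cong₂ _∷_ (<⇒<ᵇ≡true p) (bits-all s ps)

∑-cols-all : ∀ {y} s → All (y <_) s → ∀ φ → ∑ (cols 0 (bits s y)) φ ≡ φ (replicate (length s) 1)
∑-cols-all s ps φ rewrite bits-all s ps = ∑-lower-ones keepℕ flipℕ (length s) φ

-- The surplus must end at zero, so C cannot have a one at a final position outside D.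
∑-cols-snoc-false : ∀ k b φ → ∑ (cols k (b ++ [ false ])) φ ≡ ∑ (cols k b) (φ ∘ (_++ [ 0 ]))
∑-cols-snoc-false zero    []          φ = refl
∑-cols-snoc-false (suc k) []          φ = refl
∑-cols-snoc-false k       (false ∷ b) φ =
  trans (∑-lower-false keepℕ flipℕ k (b ++ [ false ]) φ)
    (trans (cong₂ _+ℤ_ (∑-cols-snoc-false k b _) (∑-cols-snoc-false (suc k) b _))
           (sym (∑-lower-false keepℕ flipℕ k b _)))
∑-cols-snoc-false zero    (true ∷ b)  φ =
  trans (∑-lower-true₀ keepℕ flipℕ (b ++ [ false ]) φ)
    (trans (∑-cols-snoc-false zero b _) (sym (∑-lower-true₀ keepℕ flipℕ b _)))
∑-cols-snoc-false (suc k) (true ∷ b)  φ =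
  trans (∑-lower-true₊ keepℕ flipℕ k (b ++ [ false ]) φ)
    (trans (cong₂ _+ℤ_ (∑-cols-snoc-false (suc k) b _) (∑-cols-snoc-false k b _))
           (sym (∑-lower-true₊ keepℕ flipℕ k b _)))

-- Since `u` has length at most i, its monomial contains neither x_i nor x_{i+1} and is a constant
-- factor for ∂_i.
∂*-⊕ : ∀ i φ u e → length u ≤ i → ∂* i φ (u ⊕ e) ≡ ∂* i (φ ∘ (u ⊕_)) e
∂*-⊕ i       φ []      e       _       = refl
∂*-⊕ i       φ (x ∷ u) []      _       = refl
∂*-⊕ (suc i) φ (x ∷ u) (y ∷ e) (s≤s l) = ∂*-⊕ i (φ ∘ (x ℕ.+ y ∷_)) u e l

⊕-comm : ∀ u v e → u ⊕ (v ⊕ e) ≡ v ⊕ (u ⊕ e)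
⊕-comm []      v       e       = refl
⊕-comm (x ∷ u) []      e       = refl
⊕-comm (x ∷ u) (y ∷ v) []      = refl
⊕-comm (x ∷ u) (y ∷ v) (z ∷ e) = cong₂ _∷_
  (trans (sym (ℕₚ.+-assoc x y z)) (trans (cong (ℕ._+ z) (ℕₚ.+-comm x y)) (ℕₚ.+-assoc y x z))) (⊕-comm u v e)

⊕-snoc-0 : ∀ u e → (u ++ [ 0 ]) ⊕ e ≡ u ⊕ e
⊕-snoc-0 []      []      = refl
⊕-snoc-0 []      (y ∷ e) = refl
⊕-snoc-0 (x ∷ u) []      = refl
⊕-snoc-0 (x ∷ u) (y ∷ e) = cong (x ℕ.+ y ∷_) (⊕-snoc-0 u e)

ones-suc-⊕ : ∀ i e → replicate (suc i) 1 ⊕ e ≡ replicate i 1 ⊕ inc i e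
ones-suc-⊕ zero    []      = refl
ones-suc-⊕ (suc i) []      = refl
ones-suc-⊕ zero    (y ∷ e) = refl
ones-suc-⊕ (suc i) (y ∷ e) = cong (suc y ∷_) (ones-suc-⊕ i e)

∑-terms-swap : ∀ {a b suf} → a < b → AtMostOneBetween a b suf →
  ∀ s pre → All (a <_) s → All (a <_) pre → ∀ φ →
  ∑ (terms s (pre ++ b ∷ a ∷ suf)) (∂* (length s ℕ.+ length pre) φ) ≡ ∑ (terms s (pre ++ a ∷ b ∷ suf)) φ
∑-terms-swap {a} {b} {suf} a<b am s [] a<s _ φ rewrite ℕₚ.+-identityʳ (length s) = begin
  ∑ (terms s (b ∷ a ∷ suf)) (∂* i φ)
    ≡⟨ ∑-mul C _ _ ⟩
  ∑ C (λ u → ∑ (mul C₁ R) (λ e → ∂* i φ (u ⊕ e)))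
    ≡⟨ ∑-lower-cong keepℕ flipℕ 0 (bits s b) (λ u len →
         trans (∑-cong (mul C₁ R) (λ e → ∂*-⊕ i φ u e (ℕₚ.≤-reflexive (trans len (Listₚ.length-map _ s)))))
         (trans (∑-mul C₁ R _)
         (trans (∑-cols-all (s ++ [ b ]) (Allₚ.++⁺ a<s (a<b ∷ [])) _)
         -- The factor x_i splits off here: the full column of `a` has i+1 ones, which are the i
         -- ones of `𝟙` followed by `inc i`.
         (trans (∑-cong R (λ e → cong (∂* i (φ ∘ (u ⊕_))) (ones-inc e)))
         (trans (∑-cong R (λ e → ∂*-⊕ i (φ ∘ (u ⊕_)) 𝟙 (inc i e) (ℕₚ.≤-reflexive (Listₚ.length-replicate i))))
                (∑-terms-∂*-inc a<b (Adj-snoc² a b s) am (λ e → φ (u ⊕ (𝟙 ⊕ e)))))))) ) ⟩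
  ∑ C (λ u → ∑ R′ (λ e → φ (u ⊕ (𝟙 ⊕ e))))
    -- In the original word `a` precedes `b`: its column `𝟙` moves to the front, and the column of
    -- `b` gains the position of `a`, where its letter is 0.
    ≡⟨ ∑-cong C (λ u → ∑-cong R′ (λ e → cong φ (trans (⊕-comm u 𝟙 e) (cong (𝟙 ⊕_) (sym (⊕-snoc-0 u e)))))) ⟩
  ∑ C (λ u → ∑ R′ (λ e → φ (𝟙 ⊕ ((u ++ [ 0 ]) ⊕ e))))
    ≡⟨ sym (∑-cols-snoc-false 0 (bits s b) _) ⟩
  ∑ (cols 0 (bits s b ++ [ false ])) (λ u → ∑ R′ (λ e → φ (𝟙 ⊕ (u ⊕ e))))
    ≡⟨ cong (λ c → ∑ (cols 0 c) (λ u → ∑ R′ (λ e → φ (𝟙 ⊕ (u ⊕ e))))) (sym bits-snoc) ⟩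
  ∑ (cols 0 (bits (s ++ [ a ]) b)) (λ u → ∑ R′ (λ e → φ (𝟙 ⊕ (u ⊕ e))))
    ≡⟨ sym (∑-mul (cols 0 (bits (s ++ [ a ]) b)) R′ _) ⟩
  ∑ (terms (s ++ [ a ]) (b ∷ suf)) (φ ∘ (𝟙 ⊕_))
    ≡⟨ sym (∑-cols-all s a<s _) ⟩
  ∑ (cols 0 (bits s a)) (λ u → ∑ (terms (s ++ [ a ]) (b ∷ suf)) (φ ∘ (u ⊕_)))
    ≡⟨ sym (∑-mul (cols 0 (bits s a)) _ φ) ⟩
  ∑ (terms s (a ∷ b ∷ suf)) φ ∎
  where
  open ≡-Reasoning
  i  = length s
  𝟙  = replicate i 1
  C  = cols 0 (bits s b)
  C₁ = cols 0 (bits (s ++ [ b ]) a)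
  R  = terms ((s ++ [ b ]) ++ [ a ]) suf
  R′ = terms ((s ++ [ a ]) ++ [ b ]) suf
  ones-inc : ∀ e → replicate (length (s ++ [ b ])) 1 ⊕ e ≡ 𝟙 ⊕ inc i e
  ones-inc e = trans (cong (λ n → replicate n 1 ⊕ e) (trans (Listₚ.length-++ s) (ℕₚ.+-comm i 1))) (ones-suc-⊕ i e)
  bits-snoc : bits (s ++ [ a ]) b ≡ bits s b ++ [ false ]
  bits-snoc = trans (Listₚ.map-++ (b <ᵇ_) s [ a ])
                    (cong (λ c → bits s b ++ [ c ]) (≤⇒<ᵇ≡false (ℕₚ.<⇒≤ a<b)))
∑-terms-swap {a} {b} {suf} a<b am s (y ∷ pre) a<s (a<y ∷ a<pre) φ = begin
  ∑ (terms s (y ∷ pre ++ b ∷ a ∷ suf)) (∂* i φ)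
    ≡⟨ ∑-mul C _ _ ⟩
  ∑ C (λ u → ∑ (terms (s ++ [ y ]) (pre ++ b ∷ a ∷ suf)) (λ e → ∂* i φ (u ⊕ e)))
    ≡⟨ ∑-lower-cong keepℕ flipℕ 0 (bits s y) (λ u len →
         trans (∑-cong (terms (s ++ [ y ]) (pre ++ b ∷ a ∷ suf)) (λ e → ∂*-⊕ i φ u e (ℕₚ.≤-trans (ℕₚ.≤-reflexive (trans len (Listₚ.length-map _ s))) (ℕₚ.m≤m+n _ _))))
         (trans (cong (λ j → ∑ (terms (s ++ [ y ]) (pre ++ b ∷ a ∷ suf)) (∂* j (φ ∘ (u ⊕_))))
                      (sym (length-snoc-+ s y (length pre))))
                (∑-terms-swap a<b am (s ++ [ y ]) pre (Allₚ.++⁺ a<s (a<y ∷ [])) a<pre (φ ∘ (u ⊕_))))) ⟩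
  ∑ C (λ u → ∑ (terms (s ++ [ y ]) (pre ++ a ∷ b ∷ suf)) (φ ∘ (u ⊕_)))
    ≡⟨ sym (∑-mul C _ φ) ⟩
  ∑ (terms s (y ∷ pre ++ a ∷ b ∷ suf)) φ ∎
  where
  open ≡-Reasoning
  i = length s ℕ.+ suc (length pre)
  C = cols 0 (bits s y)

-- The descent before the ascent is recorded through its consequence `All (a <_) pre`, which makes
-- the column of `a` full.
data FirstAscent (w : List ℕ) : Maybeℕ → Set where
  descending : AllPairs _>_ w → FirstAscent w none
  ascent     : ∀ pre a b suf → w ≡ pre ++ a ∷ b ∷ suf → All (a <_) pre → a < b →
               FirstAscent w (some (length pre))

ascFrom-view : ∀ x ys → Unique (x ∷ ys) → FirstAscent (x ∷ ys) (ascFrom x ys)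
ascFrom-view x []       _ = descending ([] ∷ [])
ascFrom-view x (y ∷ ys) ((x≢y ∷ _) ∷ uniq) with x <ᵇ y in eq
... | true  = ascent [] x y ys refl [] (<ᵇ≡true⇒< eq)
... | false with ascFrom y ys | ascFrom-view y ys uniq
...   | _ | descending (ps ∷ pss) = descending ((y<x ∷ All.map (λ z<y → ℕₚ.<-trans z<y y<x) ps) ∷ ps ∷ pss)
  where
  y<x : y < x
  y<x = ℕₚ.≤∧≢⇒< (<ᵇ≡false⇒≤ eq) (x≢y ∘ sym)
...   | _ | ascent [] a b suf refl ps a<b =
  ascent (x ∷ []) a b suf refl (ℕₚ.≤∧≢⇒< (<ᵇ≡false⇒≤ eq) (x≢y ∘ sym) ∷ []) a<b
...   | _ | ascent (z ∷ pre) a b suf refl (p ∷ ps) a<b =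
  ascent (x ∷ z ∷ pre) a b suf refl (ℕₚ.<-≤-trans p (<ᵇ≡false⇒≤ eq) ∷ p ∷ ps) a<b

firstAscent-view : ∀ w → Unique w → FirstAscent w (firstAscent w)
firstAscent-view []       _ = descending []
firstAscent-view (x ∷ ys) u = ascFrom-view x ys u

swapAt-++ : ∀ pre a b suf → swapAt (length pre) (pre ++ a ∷ b ∷ suf) ≡ pre ++ b ∷ a ∷ suf
swapAt-++ []        a b suf = refl
swapAt-++ (x ∷ pre) a b suf = cong (x ∷_) (swapAt-++ pre a b suf)

above : ℕ → List ℕ → ℕ
above x []      = 0
above x (y ∷ w) = (if x <ᵇ y then 1 else 0) ℕ.+ above x w

-- The measure matched against the fuel of `schubAux`: each swap of an ascent removes one
-- noninversion, and a word with none is decreasing.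
noninversions : List ℕ → ℕ
noninversions []      = 0
noninversions (x ∷ w) = above x w ℕ.+ noninversions w

above-swap : ∀ x pre a b suf → above x (pre ++ a ∷ b ∷ suf) ≡ above x (pre ++ b ∷ a ∷ suf)
above-swap x []        a b suf = solve 3 (λ p q r → p :+ (q :+ r) := q :+ (p :+ r)) refl
  (if x <ᵇ a then 1 else 0) (if x <ᵇ b then 1 else 0) (above x suf)
  where open ℕSolver.+-*-Solver
above-swap x (y ∷ pre) a b suf = cong ((if x <ᵇ y then 1 else 0) ℕ.+_) (above-swap x pre a b suf)

noninversions-swap : ∀ pre a b suf → a < b →
  noninversions (pre ++ a ∷ b ∷ suf) ≡ suc (noninversions (pre ++ b ∷ a ∷ suf))
noninversions-swap []        a b suf a<b
  rewrite <⇒<ᵇ≡true a<b | ≤⇒<ᵇ≡false (ℕₚ.<⇒≤ a<b) =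
  cong suc (solve 3 (λ p q r → p :+ (q :+ r) := q :+ (p :+ r)) refl (above a suf) (above b suf) (noninversions suf))
  where open ℕSolver.+-*-Solver
noninversions-swap (x ∷ pre) a b suf a<b
  rewrite above-swap x pre a b suf | noninversions-swap pre a b suf a<b = ℕₚ.+-suc _ _

above≤length : ∀ x w → above x w ≤ length w
above≤length x []      = z≤n
above≤length x (y ∷ w) with x <ᵇ y
... | true  = s≤s (above≤length x w)
... | false = ℕₚ.m≤n⇒m≤1+n (above≤length x w)

noninversions≤ : ∀ w → noninversions w ≤ length w ℕ.* length w
noninversions≤ []      = z≤n
noninversions≤ (x ∷ w) = ℕₚ.m≤n⇒m≤1+n (ℕₚ.+-mono-≤ (above≤length x w)
  (ℕₚ.≤-trans (noninversions≤ w) (ℕₚ.*-monoʳ-≤ (length w) (ℕₚ.n≤1+n (length w)))))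

stair : ℕ → List ℕ
stair zero    = []
stair (suc n) = n ∷ stair n

stair-applyUpTo : ∀ n → applyUpTo (λ k → n ∸ 1 ∸ k) n ≡ stair n
stair-applyUpTo zero          = refl
stair-applyUpTo (suc zero)    = refl
stair-applyUpTo (suc (suc n)) = cong (suc n ∷_) (stair-applyUpTo (suc n))

ones-⊕-replicate : ∀ m n v → replicate m 1 ⊕ (replicate (m ℕ.+ 1) n ++ v) ≡ replicate m (suc n) ++ n ∷ v
ones-⊕-replicate zero    n v = refl
ones-⊕-replicate (suc m) n v = cong (suc n ∷_) (ones-⊕-replicate m n v)

-- All columns are full, so the product is one monomial in which each remaining letter adds one to
-- every exponent before it.
∑-terms-descending : ∀ s w → AllPairs _>_ w → All (λ y → All (y <_) s) w → ∀ φ →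
  ∑ (terms s w) φ ≡ φ (replicate (length s) (length w) ++ stair (length w))
∑-terms-descending s []      _          _        φ =
  trans (ℤₚ.+-identityʳ _) (cong φ (sym (Listₚ.++-identityʳ _)))
∑-terms-descending s (y ∷ w) (ys ∷ yss) (p ∷ ps) φ =
  trans (∑-mul (cols 0 (bits s y)) _ φ)
    (trans (∑-cols-all s p _)
      (trans (∑-terms-descending (s ++ [ y ]) w yss (All.zipWith (λ (q , r) → Allₚ.++⁺ q (r ∷ [])) (ps , ys)) _)
        (cong φ (trans (cong (λ m → replicate (length s) 1 ⊕ (replicate m (length w) ++ stair (length w))) (Listₚ.length-++ s))
                       (ones-⊕-replicate (length s) (length w) (stair (length w)))))))

eval-staircase : ∀ w → AllPairs _>_ w → ∀ φ → eval (staircase (length w)) φ ≡ ∑ (terms [] w) φ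
eval-staircase w desc φ = begin
  + 1 *ℤ φ (map (λ k → n ∸ 1 ∸ k) (upTo n)) +ℤ + 0
    ≡⟨ trans (ℤₚ.+-identityʳ _) (ℤₚ.*-identityˡ _) ⟩
  φ (map (λ k → n ∸ 1 ∸ k) (upTo n))
    ≡⟨ cong φ (trans (Listₚ.map-upTo (λ k → n ∸ 1 ∸ k) n) (stair-applyUpTo n)) ⟩
  φ (stair n)
    ≡⟨ sym (∑-terms-descending [] w desc (All.universal (λ _ → []) w) φ) ⟩
  ∑ (terms [] w) φ ∎
  where
  open ≡-Reasoning
  n = length w

-- For lists without repetitions: no occurrence of 1432 or 1423.
Free : List ℕ → Set
Free w = ∀ x y z t → (x ∷ y ∷ z ∷ t ∷ []) ⊆ w → x ≤ z → x ≤ t → z < y → t < y → ⊥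

-- Two later values between a and b complete the ascent to a forbidden pattern, whatever their
-- mutual order. The argument `emb` keeps track of how subwords of the part still to be read,
-- preceded by the letters chosen so far, embed in the whole word.
Free⇒AtMostOneBetween : ∀ pre a b suf → a < b → Free (pre ++ a ∷ b ∷ suf) → AtMostOneBetween a b suf
Free⇒AtMostOneBetween pre a b suf a<b free = go suf (λ p → Subₚ.++⁺ˡ pre (refl ∷ refl ∷ p))
  where
  between : ∀ {y} → (y <ᵇ a) ≡ (y <ᵇ b) ⊎ ((y <ᵇ a) ≡ false × (y <ᵇ b) ≡ true)
  between {y} with y <ᵇ a in ea | y <ᵇ b in eb
  ... | true  | true  = inj₁ refl
  ... | false | false = inj₁ refl
  ... | false | true  = inj₂ (refl , refl)
  ... | true  | false = ⊥-elim (ℕₚ.<⇒≱ (ℕₚ.<-trans (<ᵇ≡true⇒< ea) a<b) (<ᵇ≡false⇒≤ eb))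
  go : ∀ v → (∀ {s} → s ⊆ v → (a ∷ b ∷ s) ⊆ pre ++ a ∷ b ∷ suf) → AtMostOneBetween a b v
  go []      emb = []
  go (y ∷ v) emb with between {y}
  ... | inj₁ eq        = skip eq (go v (λ p → emb (y ∷ʳ p)))
  ... | inj₂ (ea , eb) = one ea eb (rest v (λ p → emb (refl ∷ p)))
    where
    rest : ∀ v → (∀ {s} → s ⊆ v → (a ∷ b ∷ y ∷ s) ⊆ pre ++ a ∷ b ∷ suf) → All (SameSide a b) v
    rest []      emb = []
    rest (z ∷ v) emb with between {z}
    ... | inj₁ eq          = eq ∷ rest v (λ p → emb (z ∷ʳ p))
    ... | inj₂ (ea′ , eb′) = ⊥-elim (free a b y z (emb (refl ∷ Subₚ.[]⊆-universal v))
                               (<ᵇ≡false⇒≤ ea) (<ᵇ≡false⇒≤ ea′) (<ᵇ≡true⇒< eb) (<ᵇ≡true⇒< eb′))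

-- The two words differ only in the order of a and b, so a new subword must use both, and they stand
-- next to each other in it.
⊆-swap : ∀ pre {a b suf} {s : List ℕ} → s ⊆ pre ++ b ∷ a ∷ suf →
         s ⊆ pre ++ a ∷ b ∷ suf ⊎ (∃ λ u → ∃ λ v → s ≡ u ++ b ∷ a ∷ v × u ⊆ pre)
⊆-swap []        (_ ∷ʳ (_ ∷ʳ p))     = inj₁ (_ ∷ʳ (_ ∷ʳ p))
⊆-swap []        (_ ∷ʳ (refl ∷ p))   = inj₁ (refl ∷ (_ ∷ʳ p))
⊆-swap []        (refl ∷ (_ ∷ʳ p))   = inj₁ (_ ∷ʳ (refl ∷ p))
⊆-swap []        (refl ∷ (refl ∷ p)) = inj₂ ([] , _ , refl , [])
⊆-swap (x ∷ pre) (_ ∷ʳ p) with ⊆-swap pre p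
... | inj₁ q                = inj₁ (x ∷ʳ q)
... | inj₂ (u , v , eq , q) = inj₂ (u , v , eq , x ∷ʳ q)
⊆-swap (x ∷ pre) (refl ∷ p) with ⊆-swap pre p
... | inj₁ q                = inj₁ (refl ∷ q)
... | inj₂ (u , v , eq , q) = inj₂ (x ∷ u , v , cong (x ∷_) eq , refl ∷ q)

-- A new occurrence contains b directly followed by a. If b opens it, then b ≤ z < a, contrary to a
-- < b. Otherwise its first letter lies in `pre` and exceeds a, so it is not the smallest.
Free-swap : ∀ pre a b suf → a < b → All (a <_) pre → Free (pre ++ a ∷ b ∷ suf) → Free (pre ++ b ∷ a ∷ suf)
Free-swap pre a b suf a<b a<pre free x y z t sub x≤z x≤t z<y t<y with ⊆-swap pre sub
... | inj₁ q = free x y z t q x≤z x≤t z<y t<y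
... | inj₂ ([] , _ , refl , q) = ℕₚ.<-asym a<b (ℕₚ.≤-<-trans x≤z z<y)
... | inj₂ (_ ∷ [] , _ , refl , q) = ℕₚ.<⇒≱ (All.head (Subₚ.All-resp-⊆ q a<pre)) x≤z
... | inj₂ (_ ∷ _ ∷ [] , _ , refl , q) = ℕₚ.<⇒≱ (All.head (Subₚ.All-resp-⊆ q a<pre)) x≤t
... | inj₂ (_ ∷ _ ∷ _ ∷ [] , _ , () , q)
... | inj₂ (_ ∷ _ ∷ _ ∷ _ ∷ [] , _ , () , q)
... | inj₂ (_ ∷ _ ∷ _ ∷ _ ∷ _ ∷ _ , _ , () , q)

-- Stated for every φ because unfolding one divided difference replaces φ by `∂* i φ`, where the
-- induction hypothesis is used.
eval-schubAux : ∀ f w → Unique w → Free w → noninversions w ≤ f → ∀ φ →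
                eval (schubAux (length w) f w) φ ≡ ∑ (terms [] w) φ
eval-schubAux zero w uniq free le φ with firstAscent w | firstAscent-view w uniq
... | _ | descending desc = eval-staircase w desc φ
... | _ | ascent pre a b suf refl _ a<b with () ← subst (_≤ 0) (noninversions-swap pre a b suf a<b) le
eval-schubAux (suc f) w uniq free le φ with firstAscent w | firstAscent-view w uniq
... | _ | descending desc = eval-staircase w desc φ
... | _ | ascent pre a b suf refl a<pre a<b = begin
  eval (dd i (schubAux (length w) f (swapAt i w))) φ
    ≡⟨ eval-dd i (schubAux (length w) f (swapAt i w)) φ ⟩
  eval (schubAux (length w) f (swapAt i w)) (∂* i φ)
    ≡⟨ cong₂ (λ n v → eval (schubAux n f v) (∂* i φ)) (Permₚ.↭-length swapped) (swapAt-++ pre a b suf) ⟩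
  eval (schubAux (length w′) f w′) (∂* i φ)
    ≡⟨ eval-schubAux f w′ (Unique-resp-↭ swapped uniq) (Free-swap pre a b suf a<b a<pre free)
         (ℕₚ.≤-pred (subst (_≤ suc f) (noninversions-swap pre a b suf a<b) le)) (∂* i φ) ⟩
  ∑ (terms [] w′) (∂* i φ)
    ≡⟨ ∑-terms-swap a<b (Free⇒AtMostOneBetween pre a b suf a<b free) [] pre [] a<pre φ ⟩
  ∑ (terms [] w) φ ∎
  where
  open ≡-Reasoning
  i  = length pre
  w′ = pre ++ b ∷ a ∷ suf
  swapped : w ↭ w′
  swapped = Permₚ.++⁺ˡ pre (Perm.swap a b Perm.refl)

schubOne-supports : ∀ w → Unique w → Free w → schubOne w ≡ ∑ (supports [] w) (const (+ 1))
schubOne-supports w uniq free = begin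
  evalOne (schubert w)
    ≡⟨ ∑-cong (schubert w) (λ t → sym (ℤₚ.*-identityʳ (proj₁ t))) ⟩
  eval (schubert w) (const (+ 1))
    ≡⟨ eval-schubAux _ w uniq free (noninversions≤ w) (const (+ 1)) ⟩
  ∑ (terms [] w) (const (+ 1))
    ≡⟨ ∑-terms-1 [] w ⟩
  ∑ (supports [] w) (const (+ 1)) ∎
  where open ≡-Reasoning

-- Indicators and multiplicities in Sym m

ind : Dec P → ℤ
ind (yes _) = + 1
ind (no _)  = + 0

ind-cong : (p : Dec P) (q : Dec Q) → (P → Q) → (Q → P) → ind p ≡ ind q
ind-cong (yes _) (yes _) _ _ = refl
ind-cong (no _)  (no _)  _ _ = refl
ind-cong (yes p) (no ¬q) f _ = ⊥-elim (¬q (f p))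
ind-cong (no ¬p) (yes q) _ g = ⊥-elim (¬p (g q))

ind-no : (p : Dec P) → ¬ P → ind p ≡ + 0
ind-no (yes p) ¬p = ⊥-elim (¬p p)
ind-no (no _)  _  = refl

∑-ind : ∀ {P : A → Set} (P? : ∀ x → Dec (P x)) xs → + length (filter P? xs) ≡ ∑ xs (ind ∘ P?)
∑-ind P? []       = refl
∑-ind P? (x ∷ xs) with P? x
... | yes _ = cong (+ 1 +ℤ_) (∑-ind P? xs)
... | no _  = trans (∑-ind P? xs) (sym (ℤₚ.+-identityˡ _))

insertions-↭ : ∀ (x : A) v {z} → z ∈ insertions x v → z ↭ x ∷ v
insertions-↭ x []      (here refl) = Perm.refl
insertions-↭ x (y ∷ v) (here refl) = Perm.refl
insertions-↭ x (y ∷ v) (there z∈) with t , t∈ , refl ← ∈ₚ.∈-map⁻ (y ∷_) z∈ =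
  ↭-trans (Perm.prep y (insertions-↭ x v t∈)) (Perm.swap y x Perm.refl)

perms-↭ : ∀ (xs : List A) {v} → v ∈ perms xs → v ↭ xs
perms-↭ []       (here refl) = Perm.refl
perms-↭ (x ∷ xs) v∈ with u , u∈ , v∈u ← find (∈ₚ.∈-concatMap⁻ (insertions x) {xs = perms xs} v∈) =
  ↭-trans (insertions-↭ x u v∈u) (Perm.prep x (perms-↭ xs u∈))

-- As x is absent from `p` and from `v`, the first x of an insertion is the inserted one. Only
-- insertion at depth `length p` can match, and it does so when the rests agree.
∑-insertions-ind : ∀ x p q v → All (x ≢_) p → All (x ≢_) v →
  ∑ (insertions x v) (λ z → ind ((p ++ x ∷ q) ≟L z)) ≡ ind ((p ++ q) ≟L v)
∑-insertions-ind x [] q [] _ _ =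
  trans (ℤₚ.+-identityʳ _) (ind-cong ((x ∷ q) ≟L (x ∷ [])) (q ≟L []) Listₚ.∷-injectiveʳ (cong (x ∷_)))
∑-insertions-ind x (y ∷ p) q [] (x≢y ∷ _) _ =
  cong (_+ℤ + 0) (ind-no ((y ∷ p ++ x ∷ q) ≟L (x ∷ [])) (x≢y ∘ sym ∘ Listₚ.∷-injectiveˡ))
∑-insertions-ind x [] q (z ∷ v) _ (x≢z ∷ _) = begin
  ind ((x ∷ q) ≟L (x ∷ z ∷ v)) +ℤ ∑ (map (z ∷_) (insertions x v)) (λ t → ind ((x ∷ q) ≟L t))
    ≡⟨ cong₂ _+ℤ_ (ind-cong ((x ∷ q) ≟L (x ∷ z ∷ v)) (q ≟L (z ∷ v)) Listₚ.∷-injectiveʳ (cong (x ∷_)))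
         (trans (∑-map (z ∷_) (insertions x v) _)
           (trans (∑-cong (insertions x v) (λ t → ind-no ((x ∷ q) ≟L (z ∷ t)) (x≢z ∘ Listₚ.∷-injectiveˡ)))
                  (∑-zero (insertions x v)))) ⟩
  ind (q ≟L (z ∷ v)) +ℤ + 0
    ≡⟨ ℤₚ.+-identityʳ _ ⟩
  ind (q ≟L (z ∷ v)) ∎
  where open ≡-Reasoning
∑-insertions-ind x (y ∷ p) q (z ∷ v) (x≢y ∷ x∉p) (x≢z ∷ x∉v) = begin
  ind ((y ∷ p ++ x ∷ q) ≟L (x ∷ z ∷ v)) +ℤ ∑ (map (z ∷_) (insertions x v)) (λ t → ind ((y ∷ p ++ x ∷ q) ≟L t))
    ≡⟨ cong₂ _+ℤ_ (ind-no ((y ∷ p ++ x ∷ q) ≟L (x ∷ z ∷ v)) (x≢y ∘ sym ∘ Listₚ.∷-injectiveˡ))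
                  (∑-map (z ∷_) (insertions x v) _) ⟩
  + 0 +ℤ ∑ (insertions x v) (λ t → ind ((y ∷ p ++ x ∷ q) ≟L (z ∷ t)))
    ≡⟨ ℤₚ.+-identityˡ _ ⟩
  ∑ (insertions x v) (λ t → ind ((y ∷ p ++ x ∷ q) ≟L (z ∷ t)))
    ≡⟨ heads (y ℕₚ.≟ z) ⟩
  ind ((y ∷ p ++ q) ≟L (z ∷ v)) ∎
  where
  open ≡-Reasoning
  heads : Dec (y ≡ z) →
    ∑ (insertions x v) (λ t → ind ((y ∷ p ++ x ∷ q) ≟L (z ∷ t))) ≡ ind ((y ∷ p ++ q) ≟L (z ∷ v))
  heads (yes refl) =
    trans (∑-cong (insertions x v) (λ t →
             ind-cong ((y ∷ p ++ x ∷ q) ≟L (y ∷ t)) ((p ++ x ∷ q) ≟L t) Listₚ.∷-injectiveʳ (cong (y ∷_))))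
      (trans (∑-insertions-ind x p q v x∉p x∉v)
             (ind-cong ((p ++ q) ≟L v) ((y ∷ p ++ q) ≟L (y ∷ v)) (cong (y ∷_)) Listₚ.∷-injectiveʳ))
  heads (no y≢z) =
    trans (trans (∑-cong (insertions x v) (λ t → ind-no ((y ∷ p ++ x ∷ q) ≟L (z ∷ t)) (y≢z ∘ Listₚ.∷-injectiveˡ)))
                 (∑-zero (insertions x v)))
          (sym (ind-no ((y ∷ p ++ q) ≟L (z ∷ v)) (y≢z ∘ Listₚ.∷-injectiveˡ)))

-- This is enumeration without repetition, in the form in which a sum over `Sym m` picks out the
-- standardisation of a given subsequence.
∑-perms-ind : ∀ xs → Unique xs → ∀ u → u ↭ xs → ∑ (perms xs) (λ v → ind (u ≟L v)) ≡ + 1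
∑-perms-ind []       _             u p rewrite Permₚ.↭-empty-inv p = refl
∑-perms-ind (x ∷ xs) (x∉xs ∷ uniq) u p
  with as , bs , refl ← ∈ₚ.∈-∃++ (Permₚ.∈-resp-↭ (↭-sym p) (here refl)) =
  trans (∑-concatMap (insertions x) (perms xs) _)
    (trans (∑-cong-∈ (perms xs) (λ {v} v∈ →
              ∑-insertions-ind x as bs v
                (Allₚ.++⁻ˡ as (Permₚ.All-resp-↭ (↭-sym rest) x∉xs))
                (Permₚ.All-resp-↭ (↭-sym (perms-↭ xs v∈)) x∉xs)))
           (∑-perms-ind xs uniq (as ++ bs) rest))
  where
  rest : as ++ bs ↭ xs
  rest = Permₚ.drop-mid as [] p

-- Standardisation

countLess-↭ : ∀ x {s t} → s ↭ t → countLess x s ≡ countLess x t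
countLess-↭ x Perm.refl         = refl
countLess-↭ x (Perm.prep y p)   = cong (_ ℕ.+_) (countLess-↭ x p)
countLess-↭ x (Perm.swap {s} {t} y z p) =
  trans (cong (λ n → a ℕ.+ (b ℕ.+ n)) (countLess-↭ x p))
    (trans (sym (ℕₚ.+-assoc a b _)) (trans (cong (ℕ._+ countLess x t) (ℕₚ.+-comm a b)) (ℕₚ.+-assoc b a _)))
  where
  a = if y <ᵇ x then 1 else 0
  b = if z <ᵇ x then 1 else 0
countLess-↭ x (Perm.trans p q)  = trans (countLess-↭ x p) (countLess-↭ x q)

countLess-none : ∀ x t → All (x ≤_) t → countLess x t ≡ 0
countLess-none x []      []       = refl
countLess-none x (y ∷ t) (p ∷ ps) rewrite ≤⇒<ᵇ≡false p = countLess-none x t ps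

map-countLess-sorted : ∀ t → AllPairs _<_ t → map (λ x → countLess x t) t ≡ upTo (length t)
map-countLess-sorted []      _          = refl
map-countLess-sorted (x ∷ t) (ps ∷ pss) = cong₂ _∷_
  (countLess-none x (x ∷ t) (ℕₚ.≤-refl ∷ All.map ℕₚ.<⇒≤ ps))
  (begin
    map (λ y → countLess y (x ∷ t)) t     ≡⟨ Listₚ.map-cong-local (All.map (λ {y} x<y → cong (λ c → (if c then 1 else 0) ℕ.+ countLess y t) (<⇒<ᵇ≡true x<y)) ps) ⟩
    map (λ y → suc (countLess y t)) t     ≡⟨ Listₚ.map-∘ t ⟩
    map suc (map (λ y → countLess y t) t) ≡⟨ cong (map suc) (map-countLess-sorted t pss) ⟩
    map suc (upTo (length t))             ≡⟨ Listₚ.map-upTo suc (length t) ⟩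
    applyUpTo suc (length t)              ∎)
  where open ≡-Reasoning

-- Ranks do not depend on the order of the entries, and along the sorted list, strictly increasing
-- by uniqueness, `countLess` takes the values 0, 1, 2, and so on.
std-↭ : ∀ s → Unique s → std s ↭ oneTo (length s)
std-↭ s uniq = ↭-trans (Permₚ.map⁺ (λ x → suc (countLess x s)) (↭-sym (sort-↭ s))) (↭-reflexive (begin
  map (λ x → suc (countLess x s)) t       ≡⟨ Listₚ.map-cong (λ x → cong suc (countLess-↭ x (↭-sym (sort-↭ s)))) t ⟩
  map (λ x → suc (countLess x t)) t       ≡⟨ Listₚ.map-∘ t ⟩
  map suc (map (λ x → countLess x t) t)   ≡⟨ cong (map suc) (map-countLess-sorted t strict) ⟩
  map suc (upTo (length t))               ≡⟨ cong oneTo (Permₚ.↭-length (sort-↭ s)) ⟩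
  oneTo (length s)                        ∎))
  where
  open ≡-Reasoning
  t = sort s
  strict : AllPairs _<_ t
  strict = AllPairs.zipWith (λ (le , ne) → ℕₚ.≤∧≢⇒< le ne)
    (Sorted⇒AllPairs ℕₚ.≤-totalOrder (sort-↗ s) , Unique-resp-↭ (↭-sym (sort-↭ s)) uniq)

countLess-mono-≤ : ∀ {x y} s → x ≤ y → countLess x s ≤ countLess y s
countLess-mono-≤ []      le = z≤n
countLess-mono-≤ {x} {y} (z ∷ s) le with z <ᵇ x in ex | z <ᵇ y in ey
... | false | false = countLess-mono-≤ s le
... | false | true  = ℕₚ.m≤n⇒m≤1+n (countLess-mono-≤ s le)
... | true  | true  = s≤s (countLess-mono-≤ s le)
... | true  | false = ⊥-elim (ℕₚ.<⇒≱ (ℕₚ.<-≤-trans (<ᵇ≡true⇒< ex) le) (<ᵇ≡false⇒≤ ey))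

-- The entry x itself is counted below y but not below x, which gives strictness.
countLess-mono-< : ∀ {x y s} → x ∈ s → x < y → countLess x s < countLess y s
countLess-mono-< {x} {y} {z ∷ s} (here refl) lt
  rewrite ≤⇒<ᵇ≡false (ℕₚ.≤-refl {x}) | <⇒<ᵇ≡true lt = s≤s (countLess-mono-≤ s (ℕₚ.<⇒≤ lt))
countLess-mono-< {x} {y} {z ∷ s} (there x∈) lt with z <ᵇ x in ex | z <ᵇ y in ey
... | false | false = countLess-mono-< x∈ lt
... | false | true  = ℕₚ.m≤n⇒m≤1+n (countLess-mono-< x∈ lt)
... | true  | true  = s≤s (countLess-mono-< x∈ lt)
... | true  | false = ⊥-elim (ℕₚ.<⇒≱ (ℕₚ.<-trans (<ᵇ≡true⇒< ex) lt) (<ᵇ≡false⇒≤ ey))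

countLess-<ᵇ : ∀ {x y s} → x ∈ s → (countLess x s <ᵇ countLess y s) ≡ (x <ᵇ y)
countLess-<ᵇ {x} {y} {s} x∈ with x <ᵇ y in eq
... | true  = <⇒<ᵇ≡true (countLess-mono-< x∈ (<ᵇ≡true⇒< eq))
... | false = ≤⇒<ᵇ≡false (countLess-mono-≤ s (<ᵇ≡false⇒≤ eq))

-- Values enter `supports` only through comparisons in `bits`, whose left argument is always an
-- entry of `w`; hence P is asked of that argument.
supports-map : ∀ (P : ℕ → Set) f → (∀ {x y} → P x → (f x <ᵇ f y) ≡ (x <ᵇ y)) →
  ∀ s w → All P w → supports (map f s) (map f w) ≡ supports s w
supports-map P f mono s []      []       = cong (λ n → [ replicate n false ]) (Listₚ.length-map f s)
supports-map P f mono s (y ∷ w) (p ∷ ps) =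
  cong₂ (λ b T → concatMap (λ u → map (overlay _∨_ (close u)) T) (diffs 0 b))
    (trans (sym (Listₚ.map-∘ s)) (Listₚ.map-cong (λ x → mono p) s))
    (trans (cong (λ t → supports t (map f w)) (sym (Listₚ.map-++ f s [ y ]))) (supports-map P f mono (s ++ [ y ]) w ps))

fullCount-std : ∀ s → fullCount (std s) ≡ fullCount s
fullCount-std s = cong (λ T → ∑ T full)
  (supports-map (_∈ s) (λ x → suc (countLess x s)) countLess-<ᵇ [] s (All.tabulate id))

⊆-map⁻ : ∀ (f : A → B) {t} s → t ⊆ map f s → ∃ λ r → t ≡ map f r × r ⊆ s
⊆-map⁻ f []      []         = [] , refl , []
⊆-map⁻ f (x ∷ s) (_ ∷ʳ p)   with r , eq , q ← ⊆-map⁻ f s p = r , eq , x ∷ʳ q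
⊆-map⁻ f (x ∷ s) (refl ∷ p) with r , eq , q ← ⊆-map⁻ f s p = x ∷ r , cong (f x ∷_) eq , refl ∷ q

Free-std : ∀ s → Free s → Free (std s)
Free-std s free x y z t sub x≤z x≤t z<y t<y with ⊆-map⁻ (λ x → suc (countLess x s)) s sub
... | a ∷ b ∷ c ∷ d ∷ [] , refl , q =
  free a b c d q (reflects-≤ (Sub.lookup q c∈) x≤z) (reflects-≤ (Sub.lookup q d∈) x≤t) (reflects-< z<y) (reflects-< t<y)
  where
  c∈ = there (there (here refl))
  d∈ = there (there (there (here refl)))
  reflects-≤ : ∀ {u v} → v ∈ s → suc (countLess u s) ≤ suc (countLess v s) → u ≤ v
  reflects-≤ v∈ le = ℕₚ.≮⇒≥ (λ lt → ℕₚ.<⇒≱ (countLess-mono-< v∈ lt) (ℕₚ.≤-pred le))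
  reflects-< : ∀ {u v} → suc (countLess u s) < suc (countLess v s) → u < v
  reflects-< lt = ℕₚ.≰⇒> (λ le → ℕₚ.<⇒≱ (ℕₚ.≤-pred lt) (countLess-mono-≤ s le))

-- Subsequences

choose-⊆ : ∀ k (w : List A) {s} → s ∈ choose k w → s ⊆ w × length s ≡ k
choose-⊆ zero    w       (here refl) = Subₚ.[]⊆-universal w , refl
choose-⊆ (suc k) (x ∷ w) s∈ with ∈ₚ.∈-++⁻ (map (x ∷_) (choose k w)) s∈
... | inj₁ p with t , t∈ , refl ← ∈ₚ.∈-map⁻ (x ∷_) p with q , eq ← choose-⊆ k w t∈ = refl ∷ q , cong suc eq
... | inj₂ p with q , eq ← choose-⊆ (suc k) w p = x ∷ʳ q , eq

⊆-choose : ∀ {s w : List A} → s ⊆ w → s ∈ choose (length s) w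
⊆-choose []                   = here refl
⊆-choose {s = []}    (y ∷ʳ p) = here refl
⊆-choose {s = x ∷ s} {y ∷ w} (y ∷ʳ p) = ∈ₚ.∈-++⁺ʳ (map (y ∷_) (choose (length s) w)) (⊆-choose p)
⊆-choose {s = x ∷ s} (refl ∷ p) = ∈ₚ.∈-++⁺ˡ (∈ₚ.∈-map⁺ (x ∷_) (⊆-choose p))

Unique-⊆ : {s w : List ℕ} → s ⊆ w → Unique w → Unique s
Unique-⊆ []         _        = []
Unique-⊆ (y ∷ʳ p)   (_ ∷ u)  = Unique-⊆ p u
Unique-⊆ (refl ∷ p) (ps ∷ u) = Subₚ.All-resp-⊆ p ps ∷ Unique-⊆ p u

Free-⊆ : ∀ {s w} → s ⊆ w → Free w → Free s
Free-⊆ p free x y z t sub = free x y z t (⊆-trans sub p)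

std-1423 : ∀ {x y z t} → x < z → z < t → t < y → std (x ∷ y ∷ z ∷ t ∷ []) ≡ 1 ∷ 4 ∷ 2 ∷ 3 ∷ []
std-1423 {x} {y} {z} {t} x<z z<t t<y
  rewrite ≤⇒<ᵇ≡false (ℕₚ.≤-refl {x}) | ≤⇒<ᵇ≡false (ℕₚ.≤-refl {y})
        | ≤⇒<ᵇ≡false (ℕₚ.≤-refl {z}) | ≤⇒<ᵇ≡false (ℕₚ.≤-refl {t})
        | <⇒<ᵇ≡true x<z | ≤⇒<ᵇ≡false (ℕₚ.<⇒≤ x<z)
        | <⇒<ᵇ≡true z<t | ≤⇒<ᵇ≡false (ℕₚ.<⇒≤ z<t)
        | <⇒<ᵇ≡true t<y | ≤⇒<ᵇ≡false (ℕₚ.<⇒≤ t<y)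
        | <⇒<ᵇ≡true (ℕₚ.<-trans x<z z<t) | ≤⇒<ᵇ≡false (ℕₚ.<⇒≤ (ℕₚ.<-trans x<z z<t))
        | <⇒<ᵇ≡true (ℕₚ.<-trans z<t t<y) | ≤⇒<ᵇ≡false (ℕₚ.<⇒≤ (ℕₚ.<-trans z<t t<y))
        | <⇒<ᵇ≡true (ℕₚ.<-trans x<z (ℕₚ.<-trans z<t t<y))
        | ≤⇒<ᵇ≡false (ℕₚ.<⇒≤ (ℕₚ.<-trans x<z (ℕₚ.<-trans z<t t<y))) = refl

std-1432 : ∀ {x y z t} → x < t → t < z → z < y → std (x ∷ y ∷ z ∷ t ∷ []) ≡ 1 ∷ 4 ∷ 3 ∷ 2 ∷ []
std-1432 {x} {y} {z} {t} x<t t<z z<y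
  rewrite ≤⇒<ᵇ≡false (ℕₚ.≤-refl {x}) | ≤⇒<ᵇ≡false (ℕₚ.≤-refl {y})
        | ≤⇒<ᵇ≡false (ℕₚ.≤-refl {z}) | ≤⇒<ᵇ≡false (ℕₚ.≤-refl {t})
        | <⇒<ᵇ≡true x<t | ≤⇒<ᵇ≡false (ℕₚ.<⇒≤ x<t)
        | <⇒<ᵇ≡true t<z | ≤⇒<ᵇ≡false (ℕₚ.<⇒≤ t<z)
        | <⇒<ᵇ≡true z<y | ≤⇒<ᵇ≡false (ℕₚ.<⇒≤ z<y)
        | <⇒<ᵇ≡true (ℕₚ.<-trans x<t t<z) | ≤⇒<ᵇ≡false (ℕₚ.<⇒≤ (ℕₚ.<-trans x<t t<z))
        | <⇒<ᵇ≡true (ℕₚ.<-trans t<z z<y) | ≤⇒<ᵇ≡false (ℕₚ.<⇒≤ (ℕₚ.<-trans t<z z<y))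
        | <⇒<ᵇ≡true (ℕₚ.<-trans x<t (ℕₚ.<-trans t<z z<y))
        | ≤⇒<ᵇ≡false (ℕₚ.<⇒≤ (ℕₚ.<-trans x<t (ℕₚ.<-trans t<z z<y))) = refl

Avoids⇒¬std : ∀ {π w s} → Avoids π w → s ⊆ w → length s ≡ length π → std s ≡ π → ⊥
Avoids⇒¬std {π} {w} {s} av sub len eq
  with filter (λ s → std s ≟L π) (choose (length π) w)
     | ∈ₚ.∈-filter⁺ (λ s → std s ≟L π) (subst (λ k → s ∈ choose k w) len (⊆-choose sub)) eq
Avoids⇒¬std () sub len eq | _ ∷ _ | _

Avoids⇒Free : ∀ {w} → Unique w → Avoids (1 ∷ 4 ∷ 3 ∷ 2 ∷ []) w → Avoids (1 ∷ 4 ∷ 2 ∷ 3 ∷ []) w → Free w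
Avoids⇒Free {w} uniq av₁ av₂ x y z t sub x≤z x≤t z<y t<y with Unique-⊆ sub uniq
... | (_ ∷ x≢z ∷ x≢t ∷ []) ∷ _ ∷ (z≢t ∷ []) ∷ _ with ℕₚ.<-cmp z t
... | tri< z<t _ _ = Avoids⇒¬std av₂ sub refl (std-1423 (ℕₚ.≤∧≢⇒< x≤z x≢z) z<t t<y)
... | tri≈ _ z≡t _ = z≢t z≡t
... | tri> _ _ t<z = Avoids⇒¬std av₁ sub refl (std-1432 (ℕₚ.≤∧≢⇒< x≤t x≢t) t<z z<y)

-- Sums over subsequences and the recursion for c

∑<-head : ∀ F n → ∑< F (suc n) ≡ F 0 +ℤ ∑< (F ∘ suc) n
∑<-head F zero    = ℤₚ.+-comm (+ 0) (F 0)
∑<-head F (suc n) = trans (cong (_+ℤ F (suc n)) (∑<-head F n)) (ℤₚ.+-assoc (F 0) _ _)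

∑<-zero : ∀ n → ∑< (const (+ 0)) n ≡ + 0
∑<-zero zero    = refl
∑<-zero (suc n) = trans (ℤₚ.+-identityʳ _) (∑<-zero n)

∑<-distrib-+ : ∀ F G n → ∑< (λ m → F m +ℤ G m) n ≡ ∑< F n +ℤ ∑< G n
∑<-distrib-+ F G zero    = refl
∑<-distrib-+ F G (suc n) =
  trans (cong (_+ℤ (F n +ℤ G n)) (∑<-distrib-+ F G n)) (+-interchange (∑< F n) (∑< G n) (F n) (G n))

-- Subsets are grouped by size along the Pascal recursion of `choose`. Any bound above `length w` is
-- allowed, because the subsets with and without x call for different bounds and sizes above the
-- length contribute nothing.
∑-words-select : ∀ (w : List A) (f : List A → ℤ) n → length w < n →
  ∑ (words (length w)) (λ I → f (select I w)) ≡ ∑< (λ m → ∑ (choose m w) f) n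
∑-words-select []      f (suc n) _ = sym (begin
  ∑< (λ m → ∑ (choose m []) f) (suc n)  ≡⟨ ∑<-head (λ m → ∑ (choose m []) f) n ⟩
  (f [] +ℤ + 0) +ℤ ∑< (const (+ 0)) n   ≡⟨ cong ((f [] +ℤ + 0) +ℤ_) (∑<-zero n) ⟩
  (f [] +ℤ + 0) +ℤ + 0                  ≡⟨ ℤₚ.+-identityʳ _ ⟩
  f [] +ℤ + 0                           ∎)
  where open ≡-Reasoning
∑-words-select (x ∷ w) f (suc n) (s≤s lt) = begin
  ∑ (words (suc (length w))) (λ I → f (select I (x ∷ w)))
    ≡⟨ ∑-words-suc (length w) _ ⟩
  ∑ (words (length w)) (λ I → f (x ∷ select I w)) +ℤ ∑ (words (length w)) (λ I → f (select I w))
    ≡⟨ cong₂ _+ℤ_ (∑-words-select w (f ∘ (x ∷_)) n lt) (∑-words-select w f (suc n) (ℕₚ.m≤n⇒m≤1+n lt)) ⟩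
  ∑< G n +ℤ ∑< F (suc n)
    ≡⟨ cong (∑< G n +ℤ_) (∑<-head F n) ⟩
  ∑< G n +ℤ (F 0 +ℤ ∑< (F ∘ suc) n)
    ≡⟨ solve 3 (λ p q r → p :+ (q :+ r) := q :+ (p :+ r)) refl (∑< G n) (F 0) (∑< (F ∘ suc) n) ⟩
  F 0 +ℤ (∑< G n +ℤ ∑< (F ∘ suc) n)
    ≡⟨ cong (F 0 +ℤ_) (sym (∑<-distrib-+ G (F ∘ suc) n)) ⟩
  F 0 +ℤ ∑< (λ m → G m +ℤ F (suc m)) n
    ≡⟨ cong (F 0 +ℤ_) (∑<-cong n (λ m → sym
         (trans (∑-++ (map (x ∷_) (choose m w)) _ f) (cong (_+ℤ F (suc m)) (∑-map (x ∷_) (choose m w) f))))) ⟩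
  F 0 +ℤ ∑< (λ m → ∑ (choose (suc m) (x ∷ w)) f) n
    ≡⟨ sym (∑<-head (λ m → ∑ (choose m (x ∷ w)) f) n) ⟩
  ∑< (λ m → ∑ (choose m (x ∷ w)) f) (suc n) ∎
  where
  open ≡-Reasoning
  open ℤSolver.+-*-Solver
  F G : ℕ → ℤ
  F m = ∑ (choose m w) f
  G m = ∑ (choose m w) (f ∘ (x ∷_))

choose-> : ∀ k (w : List A) → length w < k → choose k w ≡ []
choose-> (suc k) []      _        = refl
choose-> (suc k) (x ∷ w) (s≤s lt) =
  cong₂ (λ K L → map (x ∷_) K ++ L) (choose-> k w lt) (choose-> (suc k) w (ℕₚ.m≤n⇒m≤1+n lt))

choose-length : ∀ (w : List A) → choose (length w) w ≡ [ w ]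
choose-length []      = refl
choose-length (x ∷ w) =
  cong₂ (λ K L → map (x ∷_) K ++ L) (choose-length w) (choose-> (suc (length w)) w ℕₚ.≤-refl)

-- The empty subsequence accounts for the 1 and the whole word for `fullCount w`; the sizes in
-- between are those of the recursion for c.
schubOne-choose : ∀ x v → let w = x ∷ v in Unique w → Free w →
  schubOne w ≡ + 1 +ℤ ∑ (map suc (upTo (length v))) (λ m → ∑ (choose m w) fullCount) +ℤ fullCount w
schubOne-choose x v uniq free = begin
  schubOne w
    ≡⟨ schubOne-supports w uniq free ⟩
  ∑ (supports [] w) (const (+ 1))
    ≡⟨ ∑-supports-1 w ⟩
  ∑ (words (length w)) (λ I → fullCount (select I w))
    ≡⟨ ∑-words-select w fullCount (suc (length w)) ℕₚ.≤-refl ⟩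
  ∑< F (suc (length v)) +ℤ F (length w)
    ≡⟨ cong₂ _+ℤ_ (∑<-head F (length v))
         (trans (cong (λ K → ∑ K fullCount) (choose-length w)) (ℤₚ.+-identityʳ _)) ⟩
  + 1 +ℤ ∑< (F ∘ suc) (length v) +ℤ fullCount w
    ≡⟨ cong (λ z → + 1 +ℤ z +ℤ fullCount w)
         (trans (sym (∑-upTo (F ∘ suc) (length v))) (sym (∑-map suc (upTo (length v)) F))) ⟩
  + 1 +ℤ ∑ (map suc (upTo (length v))) F +ℤ fullCount w ∎
  where
  open ≡-Reasoning
  w = x ∷ v
  F : ℕ → ℤ
  F m = ∑ (choose m w) fullCount

length-oneTo : ∀ m → length (oneTo m) ≡ m
length-oneTo m = trans (Listₚ.length-map suc (upTo m)) (Listₚ.length-upTo m)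

Unique-oneTo : ∀ m → Unique (oneTo m)
Unique-oneTo m = Uniqueₚ.map⁺ ℕₚ.suc-injective (Uniqueₚ.upTo⁺ m)

-- Double counting: an occurrence of u is a subsequence s with `std s ≡ u`, and each s has exactly
-- one such u in `Sym m`. The condition on g concerns only patterns that occur in `w`, since only
-- these inherit `Free`.
∑-Sym-occ : ∀ m w (g : List ℕ → ℤ) → Unique w →
  (∀ {s u} → s ∈ choose m w → u ∈ Sym m → std s ≡ u → g u ≡ fullCount s) →
  ∑ (Sym m) (λ u → g u *ℤ + occ u w) ≡ ∑ (choose m w) fullCount
∑-Sym-occ m w g uniq g≡ = begin
  ∑ (Sym m) (λ u → g u *ℤ + occ u w)
    ≡⟨ ∑-cong-∈ (Sym m) (λ {u} u∈ → begin
         g u *ℤ + occ u w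
           ≡⟨ cong (g u *ℤ_) (∑-ind (λ s → std s ≟L u) (choose (length u) w)) ⟩
         g u *ℤ ∑ (choose (length u) w) (λ s → ind (std s ≟L u))
           ≡⟨ cong (λ k → g u *ℤ ∑ (choose k w) (λ s → ind (std s ≟L u)))
                (trans (Permₚ.↭-length (perms-↭ (oneTo m) u∈)) (length-oneTo m)) ⟩
         g u *ℤ ∑ (choose m w) (λ s → ind (std s ≟L u))
           ≡⟨ sym (∑-*ˡ (choose m w) (g u) _) ⟩
         ∑ (choose m w) (λ s → g u *ℤ ind (std s ≟L u))
           ≡⟨ ∑-cong-∈ (choose m w) (λ {s} s∈ → scaled (std s ≟L u) (g≡ s∈ u∈)) ⟩
         ∑ (choose m w) (λ s → fullCount s *ℤ ind (std s ≟L u)) ∎) ⟩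
  ∑ (Sym m) (λ u → ∑ (choose m w) (λ s → fullCount s *ℤ ind (std s ≟L u)))
    ≡⟨ ∑-swap (Sym m) (choose m w) _ ⟩
  ∑ (choose m w) (λ s → ∑ (Sym m) (λ u → fullCount s *ℤ ind (std s ≟L u)))
    ≡⟨ ∑-cong-∈ (choose m w) (λ {s} s∈ → let sub , len = choose-⊆ m w s∈ in
         trans (∑-*ˡ (Sym m) (fullCount s) _)
           (trans (cong (fullCount s *ℤ_) (∑-perms-ind (oneTo m) (Unique-oneTo m) (std s)
                     (subst (λ k → std s ↭ oneTo k) len (std-↭ s (Unique-⊆ sub uniq)))))
                  (ℤₚ.*-identityʳ (fullCount s)))) ⟩
  ∑ (choose m w) fullCount ∎
  where
  open ≡-Reasoning
  scaled : ∀ {a b} (d : Dec P) → (P → a ≡ b) → a *ℤ ind d ≡ b *ℤ ind d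
  scaled (yes p) eq = cong (_*ℤ + 1) (eq p)
  scaled {a = a} {b} (no _) eq = trans (ℤₚ.*-zeroʳ a) (sym (ℤₚ.*-zeroʳ b))

-- Removing the 1 and, by induction, the shorter patterns from the expansion of 𝔖_w(1) over
-- subsequences leaves the term of w itself.
cAux≡fullCount : ∀ f w → Unique w → Free w → 1 ≤ length w → length w ≤ f → cAux f w ≡ fullCount w
cAux≡fullCount (suc f) w@(x ∷ v) uniq free _ (s≤s v≤f) = begin
  schubOne w -ℤ + 1 -ℤ ∑ ms (λ m → ∑ (Sym m) (λ u → cAux f u *ℤ + occ u w))
    ≡⟨ cong (λ z → schubOne w -ℤ + 1 -ℤ z) (∑-cong-∈ ms (λ {m} m∈ →
         ∑-Sym-occ m w (cAux f) uniq (λ {s} {u} s∈ u∈ eq →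
           let sub , len = choose-⊆ m w s∈
               1≤m , m≤v = bounds m∈
               uniq-u = Unique-resp-↭ (↭-sym (perms-↭ (oneTo m) u∈)) (Unique-oneTo m)
               len-u  = trans (Permₚ.↭-length (perms-↭ (oneTo m) u∈)) (length-oneTo m)
               -- A pattern that occurs is the standardisation of a subsequence of `w`, so the
               -- induction hypothesis covers it.
               free-u = subst Free eq (Free-std s (Free-⊆ sub free))
           in trans (cAux≡fullCount f u uniq-u free-u (subst (1 ≤_) (sym len-u) 1≤m)
                       (ℕₚ.≤-trans (ℕₚ.≤-reflexive len-u) (ℕₚ.≤-trans m≤v v≤f)))
                    (trans (cong fullCount (sym eq)) (fullCount-std s))))) ⟩
  schubOne w -ℤ + 1 -ℤ S
    ≡⟨ cong (λ z → z -ℤ + 1 -ℤ S) (schubOne-choose x v uniq free) ⟩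
  + 1 +ℤ S +ℤ fullCount w -ℤ + 1 -ℤ S
    ≡⟨ solve 2 (λ s d → con (+ 1) :+ s :+ d :- con (+ 1) :- s := d) refl S (fullCount w) ⟩
  fullCount w ∎
  where
  open ≡-Reasoning
  open ℤSolver.+-*-Solver
  ms = map suc (upTo (length v))
  S = ∑ ms (λ m → ∑ (choose m w) fullCount)
  bounds : ∀ {m} → m ∈ ms → 1 ≤ m × m ≤ length v
  bounds m∈ with k , k∈ , refl ← ∈ₚ.∈-map⁻ suc m∈ = s≤s z≤n , ∈ₚ.∈-upTo⁻ k∈

theorem3p13 : (n : ℕ) → 1 ≤ n → (w : List ℕ) → IsPerm n w →
    Avoids (1 ∷ 4 ∷ 3 ∷ 2 ∷ []) w → Avoids (1 ∷ 4 ∷ 2 ∷ 3 ∷ []) w →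
    + 0 ≤ℤ c w
theorem3p13 n 1≤n w w∈ av₁ av₂ =
  subst (+ 0 ≤ℤ_) (sym (cAux≡fullCount (length w) w uniq (Avoids⇒Free uniq av₁ av₂) 1≤w ℕₚ.≤-refl))
        (fullCount-nonneg w)
  where
  w↭ : w ↭ oneTo n
  w↭ = perms-↭ (oneTo n) w∈
  uniq : Unique w
  uniq = Unique-resp-↭ (↭-sym w↭) (Unique-oneTo n)
  1≤w : 1 ≤ length w
  1≤w = subst (1 ≤_) (sym (trans (Permₚ.↭-length w↭) (length-oneTo n))) 1≤n
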